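{- The parameterised problem $\mathrm{Eval}^{\Box^*}(\mathrm{HORN})$ is in $\mathrm{FPT}$. That is, there are a computable function $f\colon\mathbb N\to\mathbb N$ and a deterministic algorithm that, given an $\mathrm{LTL}^{\Box^*}_{\mathrm{CNF}}$ formula $\phi$ and a strong $\mathrm{HORN}$-backdoor $X$ of $\phi$ (with respect to $\mathcal O=\{\Box^*\}$), decides whether $\phi$ is satisfiable in time $f(|X|)\cdot|x|^{O(1)}$, where $|x|$ is the size of the input.
   Context: **Formulas.** Here the only temporal operator is $\Box^*$ ("always"). A temporal literal is $\bot$, a propositional variable $p$, or $\Box^* p$ with $p$ a propositional variable (operators are not nested). A clause is a disjunction $\lnot\lambda_1\lor\dots\lor\lnot\lambda_n\lor\lambda_{n+1}\lor\dots\lor\lambda_{n+m}$ of negated and positive temporal literals. An $\mathrm{LTL}^{\Box^*}_{\mathrm{CNF}}$ formula is a formula $\phi=\Psi\land\Box^*\Phi$, where $\Phi$ is a conjunction of such clauses and $\Psi$ is a conjunction of propositional variables from $\Phi$. It belongs to $\mathrm{HORN}$ if every clause of $\Phi$ has at most one positive temporal literal ($m\le 1$). $\mathrm{Vars}(\phi)$ is the set of propositional variables of $\phi$. **Semantics.** A temporal interpretation $\mathfrak M=(\mathbb Z,<,V)$ assigns to each propositional variable $p$ a set $V(p)\subseteq\mathbb Z$ of moments of time. $\mathfrak M,n\models p$ iff $n\in V(p)$; $\mathfrak M,n\models\Box^*\varphi$ iff $\mathfrak M,k\models\varphi$ for all $k\in\mathbb Z$; Boolean connectives and $\bot$ are interpreted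 as usual. $\varphi$ is satisfiable if $\mathfrak M,0\models\varphi$ for some temporal interpretation $\mathfrak M$. **Backdoors.** Let $X\subseteq \mathrm{Vars}(\phi)$. An assignment $\theta\colon X\cup\{\Box^*x\mid x\in X\}\to\{0,1\}$ is consistent if for every $x\in X$, $\theta(\Box^* x)=1$ implies $\theta(x)=1$. The reduct $\phi[\theta]$ is obtained from $\phi$ by deleting all clauses containing a literal satisfied by $\theta$ and deleting all literals falsified by $\theta$ from the remaining clauses; empty clauses are replaced by false and the empty formula by true. $X$ is a strong $\mathcal C$-backdoor of $\phi$ if $\phi[\theta]\in\mathcal C$ for every consistent assignment $\theta\colon X\cup\{\Box^*x\mid x\in X\}\to\{0,1\}$. **Problem $\mathrm{Eval}^{\Box^*}(\mathcal C)$.** Input: an $\mathrm{LTL}^{\Box^*}_{\mathrm{CNF}}$ formula $\phi$ and a strong $\mathcal C$-backdoor $X$ of $\phi$. Parameter: $|X|$. Question: is $\phi$ satisfiable? -}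

module Defs where

open import Data.Bool.Base using (Bool; true; false)
import Data.Bool.Properties as Bool
open import Data.Empty using () renaming (⊥ to Empty)
open import Data.Fin.Base using (Fin)
open import Data.Integer.Base using (ℤ; 0ℤ)
open import Data.List.Base using (List; []; _∷_; _++_; map; filter; length; concatMap)
import Data.List.Properties as List
open import Data.List.Relation.Binary.Subset.Propositional using (_⊆_)
open import Data.List.Relation.Unary.All using (All)
open import Data.List.Relation.Unary.Any using (Any; any?; index)
open import Data.List.Relation.Unary.Unique.Propositional using (Unique)
open import Data.Maybe.Base using (Maybe; just; nothing)
import Data.Maybe.Base as Maybe
import Data.Maybe.Properties as Maybe
open import Data.Nat.Base using (ℕ; zero; suc; _+_; _*_; _^_; _≤_)
import Data.Nat.Properties as ℕ
open import Data.Product.Base using (∃-syntax; _×_)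
open import Data.Sum.Base using (_⊎_)
open import Function.Bundles using (_⇔_)
open import Level using (0ℓ)
open import Relation.Binary.Definitions using (DecidableEquality)
open import Relation.Binary.PropositionalEquality.Core using (_≡_; refl)
open import Relation.Nullary.Decidable.Core using (Dec; yes; no; dec⇒maybe; ¬?; _⊎-dec_)
open import Relation.Nullary.Negation.Core using (¬_)
open import Relation.Unary using (Pred)

------------------------------------------------------------------------
-- Formulas

-- Propositional variables are binary words, so that a formula is a finite
-- object over a finite alphabet and its size accounts for variable names.

Var : Set
Var = List Bool

_≟ᵛ_ : DecidableEquality Var
_≟ᵛ_ = List.≡-dec Bool._≟_

open import Data.List.Membership.DecPropositional _≟ᵛ_ using (_∈_; _∈?_)

data TLit : Set where
  ⊥   : TLit
  var : Var → TLit
  □*  : Var → TLit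

-- ¬ λ₁ ∨ … ∨ ¬ λₙ ∨ λₙ₊₁ ∨ … ∨ λₙ₊ₘ  with  neg = λ₁ … λₙ,  pos = λₙ₊₁ … λₙ₊ₘ.

record Clause : Set where
  constructor _⟶_
  field
    neg : List TLit
    pos : List TLit

open Clause public

-- Ψ ∧ □* Φ  with  Ψ = ⋀ initial  and  Φ = ⋀ clauses.

record Formula : Set where
  constructor _∧□*_
  field
    initial : List Var
    clauses : List Clause

open Formula public

litVars : TLit → List Var
litVars ⊥       = []
litVars (var p) = p ∷ []
litVars (□* p)  = p ∷ []

clauseVars : Clause → List Var
clauseVars c = concatMap litVars (neg c ++ pos c)

matrixVars : Formula → List Var
matrixVars φ = concatMap clauseVars (clauses φ)

vars : Formula → List Var
vars φ = initial φ ++ matrixVars φ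

-- The side condition that Ψ is built from variables of Φ.

IsCNF : Formula → Set
IsCNF φ = initial φ ⊆ matrixVars φ

HORN : Formula → Set
HORN φ = All (λ c → length (pos c) ≤ 1) (clauses φ)

------------------------------------------------------------------------
-- Semantics over (ℤ , <)

Interpretation : Set₁
Interpretation = Var → Pred ℤ 0ℓ

infix 4 _,_⊨ˡ_ _,_⊨ᶜ_ _,_⊨_

_,_⊨ˡ_ : Interpretation → ℤ → TLit → Set
V , n ⊨ˡ ⊥     = Empty
V , n ⊨ˡ var p = V p n
V , n ⊨ˡ □* p  = ∀ k → V p k

_,_⊨ᶜ_ : Interpretation → ℤ → Clause → Set
V , n ⊨ᶜ c = Any (λ l → ¬ (V , n ⊨ˡ l)) (neg c) ⊎ Any (V , n ⊨ˡ_) (pos c)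

_,_⊨_ : Interpretation → ℤ → Formula → Set
V , n ⊨ φ = All (λ p → V p n) (initial φ) × (∀ k → All (V , k ⊨ᶜ_) (clauses φ))

Satisfiable : Formula → Set₁
Satisfiable φ = ∃[ V ] (V , 0ℤ ⊨ φ)

------------------------------------------------------------------------
-- Backdoors

-- A function  X ∪ { □* x ∣ x ∈ X } → { 0 , 1 }.  Finite sets of variables are
-- duplicate-free lists, so elements of X correspond to positions in X.

record Assignment (X : List Var) : Set where
  field
    now    : Fin (length X) → Bool
    always : Fin (length X) → Bool

open Assignment public

Consistent : ∀ {X} → Assignment X → Set
Consistent θ = ∀ i → always θ i ≡ true → now θ i ≡ true

module _ {X : List Var} (θ : Assignment X) where

  value : TLit → Maybe Bool
  value ⊥       = nothing
  value (var p) = Maybe.map (λ p∈X → now θ (index p∈X)) (dec⇒maybe (p ∈? X))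
  value (□* p)  = Maybe.map (λ p∈X → always θ (index p∈X)) (dec⇒maybe (p ∈? X))

  Has : Bool → TLit → Set
  Has b l = value l ≡ just b

  has? : ∀ b l → Dec (Has b l)
  has? b l = Maybe.≡-dec Bool._≟_ (value l) (just b)

  Satisfied : Clause → Set
  Satisfied c = Any (Has false) (neg c) ⊎ Any (Has true) (pos c)

  satisfied? : ∀ c → Dec (Satisfied c)
  satisfied? c = any? (has? false) (neg c) ⊎-dec any? (has? true) (pos c)

  deleteFalsified : Clause → Clause
  deleteFalsified c =
    filter (λ l → ¬? (has? true l)) (neg c) ⟶ filter (λ l → ¬? (has? false l)) (pos c)

-- The constants "false" and "true" as the clauses  ⊥  and  ¬ ⊥.

replaceEmptyClause : Clause → Clause
replaceEmptyClause ([] ⟶ []) = [] ⟶ (⊥ ∷ [])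
replaceEmptyClause c         = c

replaceEmptyFormula : List Clause → List Clause
replaceEmptyFormula [] = ((⊥ ∷ []) ⟶ []) ∷ []
replaceEmptyFormula cs = cs

infix 8 _[_]

-- Only Φ consists of clauses; Ψ is carried along, and is irrelevant to
-- membership in HORN.

_[_] : ∀ {X} → Formula → Assignment X → Formula
φ [ θ ] = initial φ ∧□* replaceEmptyFormula
  (map (λ c → replaceEmptyClause (deleteFalsified θ c))
       (filter (λ c → ¬? (satisfied? θ c)) (clauses φ)))

StrongBackdoor : (Formula → Set) → Formula → List Var → Set
StrongBackdoor 𝒞 φ X = ∀ (θ : Assignment X) → Consistent θ → 𝒞 (φ [ θ ])

------------------------------------------------------------------------
-- Algorithms: Jones' WHILE language over binary trees with its unit-cost
-- time measure (Computability and Complexity, MIT Press 1997).  Sharing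
-- subtrees makes all basic operations constant-time, so running times agree
-- with those of deterministic Turing machines up to a polynomial.

data Tree : Set where
  nil  : Tree
  cons : Tree → Tree → Tree

size : Tree → ℕ
size nil        = 1
size (cons s t) = 1 + size s + size t

hd tl : Tree → Tree
hd nil        = nil
hd (cons s t) = s
tl nil        = nil
tl (cons s t) = t

Register : Set
Register = ℕ

infix 20 _:=_
infixr 10 _⨾_

data Expr : Set where
  reg   : Register → Expr
  `nil  : Expr
  `cons : Expr → Expr → Expr
  `hd   : Expr → Expr
  `tl   : Expr → Expr

data Program : Set where
  _:=_          : Register → Expr → Program
  _⨾_           : Program → Program → Program
  if_then_else_ : Expr → Program → Program → Program
  while_loop_   : Expr → Program → Program

Store : Set
Store = Register → Tree

update : Store → Register → Tree → Store
update σ x t y with y ℕ.≟ x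
... | yes _ = t
... | no  _ = σ y

⟦_⟧ : Expr → Store → Tree
⟦ reg x ⟧     σ = σ x
⟦ `nil ⟧      σ = nil
⟦ `cons e f ⟧ σ = cons (⟦ e ⟧ σ) (⟦ f ⟧ σ)
⟦ `hd e ⟧     σ = hd (⟦ e ⟧ σ)
⟦ `tl e ⟧     σ = tl (⟦ e ⟧ σ)

cost : Expr → ℕ
cost (reg x)     = 1
cost `nil        = 1
cost (`cons e f) = 1 + cost e + cost f
cost (`hd e)     = 1 + cost e
cost (`tl e)     = 1 + cost e

-- σ ⊢ P ⇓ τ time t : started in store σ, P halts in store τ after time t.
-- A guard counts as true when its value is not nil.

infix 4 _⊢_⇓_time_

data _⊢_⇓_time_ (σ : Store) : Program → Store → ℕ → Set where

  assign : ∀ {x e} →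
           σ ⊢ x := e ⇓ update σ x (⟦ e ⟧ σ) time (1 + cost e)

  seq    : ∀ {P Q τ υ s t} →
           σ ⊢ P ⇓ τ time s → τ ⊢ Q ⇓ υ time t →
           σ ⊢ P ⨾ Q ⇓ υ time (s + t)

  then   : ∀ {e P Q τ t a b} → ⟦ e ⟧ σ ≡ cons a b →
           σ ⊢ P ⇓ τ time t →
           σ ⊢ if e then P else Q ⇓ τ time (1 + cost e + t)

  else   : ∀ {e P Q τ t} → ⟦ e ⟧ σ ≡ nil →
           σ ⊢ Q ⇓ τ time t →
           σ ⊢ if e then P else Q ⇓ τ time (1 + cost e + t)

  loop   : ∀ {e P τ υ s t a b} → ⟦ e ⟧ σ ≡ cons a b →
           σ ⊢ P ⇓ τ time s → τ ⊢ while e loop P ⇓ υ time t →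
           σ ⊢ while e loop P ⇓ υ time (1 + cost e + s + t)

  exit   : ∀ {e P} → ⟦ e ⟧ σ ≡ nil →
           σ ⊢ while e loop P ⇓ σ time (1 + cost e)

-- Input and output are in register 0; all other registers start as nil.

start : Tree → Store
start d zero    = d
start d (suc _) = nil

infix 4 _on_yields_time_

_on_yields_time_ : Program → Tree → Tree → ℕ → Set
P on d yields r time t = ∃[ τ ] (start d ⊢ P ⇓ τ time t × τ 0 ≡ r)

------------------------------------------------------------------------
-- Encodings

encodeBool : Bool → Tree
encodeBool false = nil
encodeBool true  = cons nil nil

encodeℕ : ℕ → Tree
encodeℕ zero    = nil
encodeℕ (suc n) = cons nil (encodeℕ n)

encodeList : ∀ {A : Set} → (A → Tree) → List A → Tree
encodeList f []       = nil
encodeList f (x ∷ xs) = cons (f x) (encodeList f xs)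

encodeVar : Var → Tree
encodeVar = encodeList encodeBool

encodeTLit : TLit → Tree
encodeTLit ⊥       = nil
encodeTLit (var p) = cons nil (encodeVar p)
encodeTLit (□* p)  = cons (cons nil nil) (encodeVar p)

encodeClause : Clause → Tree
encodeClause c = cons (encodeList encodeTLit (neg c)) (encodeList encodeTLit (pos c))

encodeFormula : Formula → Tree
encodeFormula φ =
  cons (encodeList encodeVar (initial φ)) (encodeList encodeClause (clauses φ))

------------------------------------------------------------------------
-- Parameterised problems

record ParameterisedProblem : Set₂ where
  field
    Instance  : Set
    encode    : Instance → Tree
    parameter : Instance → ℕ
    Question  : Instance → Set₁

Computable : (ℕ → ℕ) → Set
Computable f = ∃[ P ] ∀ n → ∃[ t ] (P on encodeℕ n yields encodeℕ (f n) time t)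

-- A constant factor in the polynomial |x|^O(1) can be absorbed into f.

FPT : ParameterisedProblem → Set₁
FPT problem =
  ∃[ f ] Computable f × (∃[ P ] ∃[ c ] ∀ x → ∃[ b ] ∃[ t ]
    ( P on encode x yields encodeBool b time t
    × t ≤ f (parameter x) * size (encode x) ^ c
    × (b ≡ true ⇔ Question x)))
  where open ParameterisedProblem problem

-- Being a strong backdoor is a promise on the input; the algorithm only
-- receives the encoding of φ and X.

record EvalInstance (𝒞 : Formula → Set) : Set where
  field
    φ        : Formula
    X        : List Var
    isCNF    : IsCNF φ
    distinct : Unique X
    X⊆vars   : X ⊆ vars φ
    backdoor : StrongBackdoor 𝒞 φ X

Eval□* : (Formula → Set) → ParameterisedProblem
Eval□* 𝒞 = record
  { Instance  = EvalInstance 𝒞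
  ; encode    = λ I → cons (encodeFormula (φ I)) (encodeList encodeVar (X I))
  ; parameter = λ I → length (X I)
  ; Question  = λ I → Satisfiable (φ I)
  }
  where open EvalInstance

{-# OPTIONS --safe #-}

-- Label every moment k ∈ ℤ by one bit telling whether k = 0 and one bit per
-- backdoor variable.  An interpretation realises a set G of labels, and there
-- are at most 2 ^ 2 ^ (|X| + 1) such sets, so all of them can be tried.  Once
-- G is fixed, the truth values of x and □* x are known at every label for each
-- x ∈ X, the reducts are Horn, and unit propagation over the atoms "p holds at
-- every moment labelled ℓ" and "□* p" decides in polynomial time whether G can
-- be realised: the rule from "p at every ℓ ∈ G" to □* p is again Horn.
--
-- Satisfiability quantifies over arbitrary predicates on ℤ, so completeness
-- is argued under a double negation, which is harmless as the verdict of the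
-- algorithm is decidable.  Programs are obtained from combinators for
-- polynomial-time functions on trees; the factor f of the time bound iterates
-- the size bound of the step that builds the sets G, |X| + 1 times.

module Submission where

open import Data.Bool.Base using (Bool; true; false; not; _∧_) renaming (if_then_else_ to ifᵇ_then_else_)
import Data.Bool.Properties as Bool
open import Data.Empty using () renaming (⊥ to Empty)
open import Data.Integer.Base using (ℤ; 0ℤ; -[1+_])
import Data.Integer.Base as ℤ
import Data.Integer.Properties as ℤ
open import Data.List.Base using (List; []; _∷_; _++_; map; concatMap; length; lookup)
open import Data.List.Properties using (length-map)
import Data.List.Membership.DecPropositional as DecMembership
open import Data.List.Membership.Propositional using (_∈_; _∉_; find; lose)
open import Data.List.Membership.Propositional.Properties
  using (∈-map⁺; ∈-map⁻; ∈-++⁺ˡ; ∈-++⁺ʳ; ∈-++⁻; ∈-concatMap⁺; ∈-concatMap⁻; ∈-filter⁺; ∈-lookup)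
open import Data.List.Relation.Binary.Subset.Propositional using (_⊆_)
open import Data.List.Relation.Unary.All as All using (All; []; _∷_; all?)
import Data.List.Relation.Unary.All.Properties as All
open import Data.List.Relation.Unary.Any as Any using (Any; here; there; any?)
import Data.List.Relation.Unary.Any.Properties as Any
open import Data.Maybe.Base using (just; nothing)
open import Data.Nat.Base
open import Data.Nat.Properties
open import Data.Nat.Tactic.RingSolver using (solve-∀)
open import Data.Product.Base using (∃-syntax; _×_; _,_; proj₁; proj₂; uncurry)
open import Data.Sum.Base using (_⊎_; inj₁; inj₂; [_,_]′)
open import Function.Base using (_∘_; id)
open import Function.Bundles using (_⇔_; mk⇔)
open import Relation.Binary.Definitions using (DecidableEquality)
open import Relation.Binary.PropositionalEquality
open import Relation.Nullary using (Dec; yes; no; does; ¬_; contradiction)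
open import Relation.Nullary.Decidable
  using (map′; _×-dec_; _⊎-dec_; ¬?; ¬¬-excluded-middle; dec-true; dec-false; decidable-stable)
open import Relation.Unary using (Decidable)

open import Defs

-- The reducts are never computed. A clause instantiated at a label becomes a rule with several
-- conclusions; when it fires and no conclusion is present, the first one outside the backdoor is
-- added, or falsum if there is none. Backdoor literals that are true under a realised guess are
-- facts from the start, so the absent ones are false and the clause survives in the reduct of that
-- moment; the promise then leaves a single candidate, and no branching arises. Soundness, by
-- contrast, reads a model off any falsum-free set of atoms closed under the rules. Two obstacles
-- shape the rest. Double negation does not pass through a quantifier over ℤ, so `V p k` cannot be
-- assumed decided at all moments; `BoolModel` keeps those truths that the proof of satisfaction
-- itself exhibits.

private variable
  A A′ : Set
  f g h i l b p : Tree → Tree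

-- Polynomials with natural coefficients

infixl 6 _⊕_
infixl 7 _⊗_

data Poly : Set where
  𝕏       : Poly
  con     : ℕ → Poly
  _⊕_ _⊗_ : Poly → Poly → Poly

eval : Poly → ℕ → ℕ
eval 𝕏       n = n
eval (con c) n = c
eval (p ⊕ q) n = eval p n + eval q n
eval (p ⊗ q) n = eval p n * eval q n

eval-mono : ∀ p {m n} → m ≤ n → eval p m ≤ eval p n
eval-mono 𝕏       m≤n = m≤n
eval-mono (con c) m≤n = ≤-refl
eval-mono (p ⊕ q) m≤n = +-mono-≤ (eval-mono p m≤n) (eval-mono q m≤n)
eval-mono (p ⊗ q) m≤n = *-mono-≤ (eval-mono p m≤n) (eval-mono q m≤n)

infixl 8 _⟪_⟫

_⟪_⟫ : Poly → Poly → Poly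
𝕏       ⟪ r ⟫ = r
con c   ⟪ r ⟫ = con c
(p ⊕ q) ⟪ r ⟫ = p ⟪ r ⟫ ⊕ q ⟪ r ⟫
(p ⊗ q) ⟪ r ⟫ = p ⟪ r ⟫ ⊗ q ⟪ r ⟫

eval-⟪⟫ : ∀ p r n → eval (p ⟪ r ⟫) n ≡ eval p (eval r n)
eval-⟪⟫ 𝕏       r n = refl
eval-⟪⟫ (con c) r n = refl
eval-⟪⟫ (p ⊕ q) r n = cong₂ _+_ (eval-⟪⟫ p r n) (eval-⟪⟫ q r n)
eval-⟪⟫ (p ⊗ q) r n = cong₂ _*_ (eval-⟪⟫ p r n) (eval-⟪⟫ q r n)

eval-≤-⟪⟫ : ∀ p r {m n} → m ≤ eval r n → eval p m ≤ eval (p ⟪ r ⟫) n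
eval-≤-⟪⟫ p r {m} {n} m≤ = ≤-trans (eval-mono p m≤) (≤-reflexive (sym (eval-⟪⟫ p r n)))

-- The base is `suc n` rather than `n`: it is never 0, so both exponents of a sum may be raised to
-- `E + F`.
monomial-bound : ∀ p → ∃[ C ] ∃[ E ] ∀ n → eval p n ≤ C * suc n ^ E
monomial-bound 𝕏       = 1 , 1 , λ n → begin
  n                ≤⟨ n≤1+n n ⟩
  suc n            ≡⟨ sym (trans (*-identityˡ _) (*-identityʳ _)) ⟩
  1 * suc n ^ 1    ∎
  where open ≤-Reasoning
monomial-bound (con c) = c , 0 , λ n → ≤-reflexive (sym (*-identityʳ c))
monomial-bound (p ⊕ q) with monomial-bound p | monomial-bound q
... | C , E , p≤ | D , F , q≤ = C + D , E + F , λ n → begin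
  eval p n + eval q n                            ≤⟨ +-mono-≤ (p≤ n) (q≤ n) ⟩
  C * suc n ^ E + D * suc n ^ F                  ≤⟨ +-mono-≤ (*-monoʳ-≤ C (^-monoʳ-≤ (suc n) (m≤m+n E F)))
                                                             (*-monoʳ-≤ D (^-monoʳ-≤ (suc n) (m≤n+m F E))) ⟩
  C * suc n ^ (E + F) + D * suc n ^ (E + F)      ≡⟨ *-distribʳ-+ (suc n ^ (E + F)) C D ⟨
  (C + D) * suc n ^ (E + F)                      ∎
  where open ≤-Reasoning
monomial-bound (p ⊗ q) with monomial-bound p | monomial-bound q
... | C , E , p≤ | D , F , q≤ = C * D , E + F , λ n → begin
  eval p n * eval q n                            ≤⟨ *-mono-≤ (p≤ n) (q≤ n) ⟩
  (C * suc n ^ E) * (D * suc n ^ F)              ≡⟨ [m*n]*[o*p]≡[m*o]*[n*p] C (suc n ^ E) D (suc n ^ F) ⟩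
  C * D * (suc n ^ E * suc n ^ F)                ≡⟨ cong (C * D *_) (^-distribˡ-+-* (suc n) E F) ⟨
  C * D * suc n ^ (E + F)                        ∎
  where open ≤-Reasoning

-- Polynomial-time functions on trees

1≤size : ∀ t → 1 ≤ size t
1≤size nil        = ≤-refl
1≤size (cons s t) = s≤s z≤n

size-hd : ∀ t → size (hd t) ≤ size t
size-hd nil        = ≤-refl
size-hd (cons s t) = ≤-trans (m≤m+n (size s) (size t)) (n≤1+n _)

size-tl : ∀ t → size (tl t) ≤ size t
size-tl nil        = ≤-refl
size-tl (cons s t) = ≤-trans (m≤n+m (size t) (size s)) (n≤1+n _)

-- Programs work on register 0; register 1 holds a stack, which they restore.

record Run (P : Program) (σ : Store) (result : Tree) (bound : ℕ) : Set where
  constructor run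
  field
    {τ}     : Store
    {t}     : ℕ
    halts   : σ ⊢ P ⇓ τ time t
    output  : τ 0 ≡ result
    stack   : τ 1 ≡ σ 1
    in-time : t ≤ bound

-- Repeating the assignment of `cons x x` to `x` yields exponential size in linear time. Composition
-- therefore needs a size bound next to the time bound.
record PolyTime (f : Tree → Tree) : Set where
  field
    prog         : Program
    timeBound    : Poly
    sizeBound    : Poly
    runs         : ∀ σ → Run prog σ (f (σ 0)) (eval timeBound (size (σ 0)))
    size-bounded : ∀ d → size (f d) ≤ eval sizeBound (size d)

open PolyTime

opaque
  polyTime-resp : (∀ d → f d ≡ g d) → PolyTime f → PolyTime g
  polyTime-resp f≗g F = record
    { prog         = prog F
    ; timeBound    = timeBound F
    ; sizeBound    = sizeBound F
    ; runs         = λ σ → let run e o s b = runs F σ in run e (trans o (f≗g (σ 0))) s b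
    ; size-bounded = λ d → ≤-trans (≤-reflexive (cong size (sym (f≗g d)))) (size-bounded F d)
    }

infixr 9 _∘ᴾ_

opaque
  _∘ᴾ_ : PolyTime g → PolyTime f → PolyTime (g ∘ f)
  _∘ᴾ_ {g} {f} G F = record
    { prog         = prog F ⨾ prog G
    ; timeBound    = timeBound F ⊕ timeBound G ⟪ sizeBound F ⟫
    ; sizeBound    = sizeBound G ⟪ sizeBound F ⟫
    ; runs         = λ σ → runs′ σ (runs F σ)
    ; size-bounded = λ d → ≤-trans (size-bounded G (f d))
                                   (eval-≤-⟪⟫ (sizeBound G) (sizeBound F) (size-bounded F d))
    }
    where
    runs′ : ∀ σ → Run (prog F) σ (f (σ 0)) (eval (timeBound F) (size (σ 0))) →
           Run (prog F ⨾ prog G) σ (g (f (σ 0)))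
               (eval (timeBound F ⊕ timeBound G ⟪ sizeBound F ⟫) (size (σ 0)))
    runs′ σ (run {τ} e o s b) with runs G τ
    ... | run e′ o′ s′ b′ = run (seq e e′) (trans o′ (cong g o)) (trans s′ s)
      (+-mono-≤ b (≤-trans b′ (eval-≤-⟪⟫ (timeBound G) (sizeBound F)
        (≤-trans (≤-reflexive (cong size o)) (size-bounded F (σ 0))))))

  idᴾ : PolyTime id
  idᴾ = record
    { prog = 0 := reg 0 ; timeBound = con 2 ; sizeBound = 𝕏
    ; runs = λ σ → run assign refl refl ≤-refl ; size-bounded = λ d → ≤-refl }

private
  hdᴾ′ : PolyTime hd
  hdᴾ′ = record
    { prog = 0 := `hd (reg 0) ; timeBound = con 3 ; sizeBound = 𝕏
    ; runs = λ σ → run assign refl refl ≤-refl ; size-bounded = size-hd }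

  tlᴾ′ : PolyTime tl
  tlᴾ′ = record
    { prog = 0 := `tl (reg 0) ; timeBound = con 3 ; sizeBound = 𝕏
    ; runs = λ σ → run assign refl refl ≤-refl ; size-bounded = size-tl }

opaque
  hdᴾ : PolyTime f → PolyTime (hd ∘ f)
  hdᴾ F = hdᴾ′ ∘ᴾ F

  tlᴾ : PolyTime f → PolyTime (tl ∘ f)
  tlᴾ F = tlᴾ′ ∘ᴾ F

  nilᴾ : PolyTime (λ _ → nil)
  nilᴾ = record
    { prog = 0 := `nil ; timeBound = con 2 ; sizeBound = con 1
    ; runs = λ σ → run assign refl refl ≤-refl ; size-bounded = λ d → ≤-refl }

  -- The only combinator that itself writes register 1: the input waits on the stack while `prog F`
  -- runs, and the value of `f` joins it there while `prog G` runs. The five assignments cost 25 in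
  -- total.
  consᴾ : PolyTime f → PolyTime g → PolyTime (λ d → cons (f d) (g d))
  consᴾ {f} {g} F G = record
    { prog         = program
    ; timeBound    = timeBound F ⊕ timeBound G ⊕ con 25
    ; sizeBound    = con 1 ⊕ sizeBound F ⊕ sizeBound G
    ; runs         = runs′
    ; size-bounded = λ d → s≤s (+-mono-≤ (size-bounded F d) (size-bounded G d))
    }
    where
    program : Program
    program = 1 := `cons (reg 0) (reg 1)
            ⨾ prog F
            ⨾ 1 := `cons (`cons (reg 0) (`hd (reg 1))) (`tl (reg 1))
            ⨾ 0 := `tl (`hd (reg 1))
            ⨾ prog G
            ⨾ 0 := `cons (`hd (`hd (reg 1))) (reg 0)
            ⨾ 1 := `tl (reg 1)
    runs′ : ∀ σ → Run program σ (cons (f (σ 0)) (g (σ 0)))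
                      (eval (timeBound F ⊕ timeBound G ⊕ con 25) (size (σ 0)))
    runs′ σ with runs F (update σ 1 (cons (σ 0) (σ 1)))
    ... | run {τ} {t} e o s b
        with runs G (update (update τ 1 (cons (cons (τ 0) (hd (τ 1))) (tl (τ 1)))) 0 (hd (τ 1)))
    ... | run {υ} {u} e′ o′ s′ b′ = run
      (seq assign (seq e (seq assign (seq assign (seq e′ (seq assign assign))))))
      (cong₂ cons (trans (cong (hd ∘ hd) s′) o) (trans o′ (cong (g ∘ hd) s)))
      (trans (cong tl s′) (cong tl s))
      (begin
        4 + (t + (8 + (4 + (u + (6 + 3)))))
          ≡⟨ arrange t u ⟩
        t + u + 25
          ≤⟨ +-mono-≤ (+-mono-≤ b (≤-trans b′ (≤-reflexive (cong (eval (timeBound G) ∘ size ∘ hd) s)))) ≤-refl ⟩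
        eval (timeBound F) (size (σ 0)) + eval (timeBound G) (size (σ 0)) + 25 ∎)
      where
      open ≤-Reasoning
      arrange : ∀ t u → 4 + (t + (8 + (4 + (u + (6 + 3))))) ≡ t + u + 25
      arrange = solve-∀

ifT : Tree → Tree → Tree → Tree
ifT nil        a b = b
ifT (cons _ _) a b = a

size-ifT : ∀ c {a b n} → size a ≤ n → size b ≤ n → size (ifT c a b) ≤ n
size-ifT nil        a≤ b≤ = b≤
size-ifT (cons _ _) a≤ b≤ = a≤

opaque
  ifᴾ : PolyTime h → PolyTime f → PolyTime g → PolyTime (λ d → ifT (h d) (f d) (g d))
  ifᴾ {h} {f} {g} H F G = record
    { prog         = program
    ; timeBound    = time
    ; sizeBound    = sizeBound F ⊕ sizeBound G
    ; runs         = runs′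
    ; size-bounded = λ d → size-ifT (h d) (≤-trans (size-bounded F d) (m≤m+n _ _))
                                          (≤-trans (size-bounded G d) (m≤n+m _ _))
    }
    where
    H×id : PolyTime (λ d → cons (h d) d)
    H×id = consᴾ H idᴾ
    program : Program
    program = prog H×id ⨾ if `hd (reg 0) then (0 := `tl (reg 0) ⨾ prog F)
                                         else (0 := `tl (reg 0) ⨾ prog G)
    time : Poly
    time = timeBound H×id ⊕ (con 6 ⊕ (timeBound F ⊕ timeBound G))
    runs′ : ∀ σ → Run program σ (ifT (h (σ 0)) (f (σ 0)) (g (σ 0))) (eval time (size (σ 0)))
    runs′ σ with runs H×id σ | h (σ 0) in eq
    ... | run {τ} e o s bd | nil with runs G (update τ 0 (tl (τ 0)))
    ...   | run e′ o′ s′ bd′ = run (seq e (else (trans (cong hd o) eq) (seq assign e′)))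
            (trans o′ (cong (g ∘ tl) o)) (trans s′ s)
            (+-mono-≤ bd (+-monoʳ-≤ 6 (≤-trans bd′
              (≤-trans (≤-reflexive (cong (eval (timeBound G) ∘ size ∘ tl) o)) (m≤n+m _ _)))))
    runs′ σ | run {τ} e o s bd | cons _ _ with runs F (update τ 0 (tl (τ 0)))
    ...   | run e′ o′ s′ bd′ = run (seq e (then (trans (cong hd o) eq) (seq assign e′)))
            (trans o′ (cong (f ∘ tl) o)) (trans s′ s)
            (+-mono-≤ bd (+-monoʳ-≤ 6 (≤-trans bd′
              (≤-trans (≤-reflexive (cong (eval (timeBound F) ∘ size ∘ tl) o)) (m≤m+n _ _)))))

-- Folds over lists as while loops

foldlT : (Tree → Tree → Tree) → Tree → Tree → Tree
foldlT s a nil         = a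
foldlT s a (cons x xs) = foldlT s (s x a) xs

foldrT : (Tree → Tree → Tree) → Tree → Tree → Tree
foldrT s a nil         = a
foldrT s a (cons x xs) = s x (foldrT s a xs)

module Loop {s : Tree → Tree} (S : PolyTime s) where

  step : Tree → Tree → Tree → Tree
  step env x acc = s (cons x (cons acc env))

  next : Tree → Tree
  next d = cons (tl (hd d)) (cons (s (cons (hd (hd d)) (tl d))) (tl (tl d)))

  opaque
    body : PolyTime next
    body = consᴾ (tlᴾ (hdᴾ idᴾ))
                 (consᴾ (S ∘ᴾ consᴾ (hdᴾ (hdᴾ idᴾ)) (tlᴾ idᴾ)) (tlᴾ (tlᴾ idᴾ)))

  loopᴾ : Program
  loopᴾ = while `hd (reg 0) loop prog body

  -- Separates the timing of a loop from the source of its size bound: folds obtain `M` from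
  -- additive growth, iterations from `iterateBound`.
  data Bounded (env : Tree) (M : ℕ) : Tree → Tree → Set where
    done : ∀ {acc} → size acc ≤ M → Bounded env M acc nil
    more : ∀ {acc x xs} → size acc ≤ M → Bounded env M (step env x acc) xs →
           Bounded env M acc (cons x xs)

  bounded-result : ∀ {env M acc xs} → Bounded env M acc xs → size (foldlT (step env) acc xs) ≤ M
  bounded-result (done acc≤M)  = acc≤M
  bounded-result (more _ rest) = bounded-result rest

  loop-runs : ∀ env M N {acc xs} → Bounded env M acc xs → 2 + size xs + M + size env ≤ N →
              ∀ σ → σ 0 ≡ cons xs (cons acc env) →
              Run loopᴾ σ (cons nil (cons (foldlT (step env) acc xs) env))
                          (size xs * (3 + eval (timeBound body) N))
  loop-runs env M N (done _) _ σ σ0 = run (exit (cong hd σ0)) σ0 refl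
    -- `size nil` is 1, and this unit pays for the last test of the guard.
    (≤-trans (m≤m+n 3 _) (≤-reflexive (sym (*-identityˡ _))))
  loop-runs env M N {acc} {cons x xs} (more acc≤M rest) fits σ σ0 with runs body σ
  ... | run {τ} {t} e o s bd
      with loop-runs env M N rest (≤-trans (+-monoˡ-≤ (size env) (+-monoˡ-≤ M (s≤s (s≤s (size-tl (cons x xs)))))) fits)
             τ (trans o (cong next σ0))
  ... | run {υ} {u} e′ o′ s′ bd′ = run (loop (cong hd σ0) e e′) o′ (trans s′ s) (begin
    3 + t + u                            ≤⟨ +-mono-≤ (+-monoʳ-≤ 3 (≤-trans bd (eval-mono (timeBound body) state≤N))) bd′ ⟩
    B + size xs * B                      ≤⟨ *-monoˡ-≤ B (s≤s (m≤n+m (size xs) (size x))) ⟩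
    size (cons x xs) * B                 ∎)
    where
    open ≤-Reasoning
    B = 3 + eval (timeBound body) N
    state≤N : size (σ 0) ≤ N
    state≤N = begin
      size (σ 0)                                         ≡⟨ cong size σ0 ⟩
      1 + size (cons x xs) + (1 + size acc + size env)   ≡⟨ arrange (size (cons x xs)) (size acc) (size env) ⟩
      2 + size (cons x xs) + size acc + size env         ≤⟨ +-monoˡ-≤ (size env) (+-monoʳ-≤ (2 + size (cons x xs)) acc≤M) ⟩
      2 + size (cons x xs) + M + size env                ≤⟨ fits ⟩
      N                                                  ∎
      where
      arrange : ∀ k a e → 1 + k + (1 + a + e) ≡ 2 + k + a + e
      arrange = solve-∀

-- The coefficient 1 of `size acc` is the point: increments that depend only on the element and the
-- environment add up to a polynomial, whereas a larger coefficient would compound exponentially.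
Growth : (Tree → Tree) → Poly → Set
Growth s g = ∀ x acc env → size (s (cons x (cons acc env))) ≤ size acc + eval g (size x + size env)

opaque
  foldlᴾ : ∀ {s} → PolyTime s → (g : Poly) → Growth s g → PolyTime b → PolyTime l →
           PolyTime (λ d → foldlT (λ x acc → s (cons x (cons acc d))) (b d) (l d))
  foldlᴾ {b} {l} {s} S g growth B L = record
    { prog         = program
    ; timeBound    = time
    ; sizeBound    = M
    ; runs         = runs′
    ; size-bounded = λ d → bounded-result (fold-bounded d)
    }
    where
    open Loop S
    M N : Poly
    -- The size of the list bounds the number of rounds; together with the size of the input it also
    -- bounds the argument of `g` in each round.
    M = sizeBound B ⊕ sizeBound L ⊗ g ⟪ sizeBound L ⊕ 𝕏 ⟫
    N = con 2 ⊕ sizeBound L ⊕ M ⊕ 𝕏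
    initial′ : PolyTime (λ d → cons (l d) (cons (b d) d))
    initial′ = consᴾ L (consᴾ B idᴾ)
    bounded : ∀ env G m acc xs → eval g (size xs + size env) ≤ G → size acc + size xs * G ≤ m →
              Bounded env m acc xs
    bounded env G m acc nil         g≤G fits = done (≤-trans (m≤m+n _ _) fits)
    bounded env G m acc (cons x xs) g≤G fits = more (≤-trans (m≤m+n _ _) fits)
      (bounded env G m (step env x acc) xs
        (≤-trans (eval-mono g (+-monoˡ-≤ (size env) (size-tl (cons x xs)))) g≤G)
        (begin
          size (step env x acc) + size xs * G
            ≤⟨ +-monoˡ-≤ (size xs * G) (≤-trans (growth x acc env) (+-monoʳ-≤ (size acc)
                 (≤-trans (eval-mono g (+-monoˡ-≤ (size env) (size-hd (cons x xs)))) g≤G))) ⟩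
          size acc + G + size xs * G
            ≡⟨ +-assoc (size acc) G _ ⟩
          size acc + suc (size xs) * G
            ≤⟨ +-monoʳ-≤ (size acc) (*-monoˡ-≤ G (s≤s (m≤n+m (size xs) (size x)))) ⟩
          size acc + size (cons x xs) * G
            ≤⟨ fits ⟩
          m ∎))
      where open ≤-Reasoning
    fold-bounded : ∀ d → Bounded d (eval M (size d)) (b d) (l d)
    fold-bounded d = bounded d (eval (g ⟪ sizeBound L ⊕ 𝕏 ⟫) (size d)) _ (b d) (l d)
      (eval-≤-⟪⟫ g (sizeBound L ⊕ 𝕏) (+-monoˡ-≤ (size d) (size-bounded L d)))
      (+-mono-≤ (size-bounded B d) (*-monoˡ-≤ _ (size-bounded L d)))
    program : Program
    program = prog initial′ ⨾ loopᴾ ⨾ 0 := `hd (`tl (reg 0))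
    time : Poly
    time = timeBound initial′ ⊕ (sizeBound L ⊗ (con 3 ⊕ timeBound body ⟪ N ⟫) ⊕ con 4)
    runs′ : ∀ σ → Run program σ (foldlT (step (σ 0)) (b (σ 0)) (l (σ 0))) (eval time (size (σ 0)))
    runs′ σ with runs initial′ σ
    ... | run {τ} e o s bd with loop-runs (σ 0) (eval M (size (σ 0))) (eval N (size (σ 0))) (fold-bounded (σ 0))
               (+-monoˡ-≤ (size (σ 0)) (+-monoˡ-≤ (eval M (size (σ 0))) (+-monoʳ-≤ 2 (size-bounded L (σ 0))))) τ o
    ... | run e′ o′ s′ bd′ = run (seq e (seq e′ assign)) (cong (hd ∘ tl) o′) (trans s′ s)
      (+-mono-≤ bd (+-monoˡ-≤ 4 (≤-trans bd′ (*-mono-≤ (size-bounded L (σ 0))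
        (+-monoʳ-≤ 3 (≤-reflexive (sym (eval-⟪⟫ (timeBound body) N _))))))))

reverseT : Tree → Tree
reverseT xs = foldlT cons nil xs

foldrT-reverse : ∀ s b xs → foldlT s b (reverseT xs) ≡ foldrT s b xs
foldrT-reverse s b xs = go xs nil
  where
  go : ∀ xs acc → foldlT s b (foldlT cons acc xs) ≡ foldlT s (foldrT s b xs) acc
  go nil         acc = refl
  go (cons x xs) acc = go xs (cons x acc)

opaque
  -- A loop consumes a list from its head, so the right fold is run as a left fold over the reversed
  -- list.
  foldrᴾ : ∀ {s} → PolyTime s → (g : Poly) → Growth s g → PolyTime b → PolyTime l →
           PolyTime (λ d → foldrT (λ x acc → s (cons x (cons acc d))) (b d) (l d))
  foldrᴾ {b} {l} S g growth B L = polyTime-resp (λ d → foldrT-reverse _ (b d) (l d))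
    (foldlᴾ S g growth B reversed)
    where
    reversed : PolyTime (λ d → reverseT (l d))
    reversed = foldlᴾ (consᴾ (hdᴾ idᴾ) (hdᴾ (tlᴾ idᴾ))) (con 1 ⊕ 𝕏)
      (λ x acc env → ≤-trans
        (s≤s (≤-trans (≤-reflexive (+-comm (size x) (size acc))) (+-monoʳ-≤ (size acc) (m≤m+n (size x) (size env)))))
                             (≤-reflexive (sym (+-suc (size acc) _))))
      nilᴾ L

constᴾ : ∀ t → PolyTime (λ _ → t)
constᴾ nil        = nilᴾ
constᴾ (cons s t) = consᴾ (constᴾ s) (constᴾ t)

trueT : Tree
trueT = encodeBool true

trueᴾ : PolyTime (λ _ → trueT)
trueᴾ = constᴾ trueT

notT : Tree → Tree
notT c = ifT c nil trueT

notᴾ : PolyTime f → PolyTime (λ d → notT (f d))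
notᴾ F = ifᴾ F nilᴾ trueᴾ

andT : Tree → Tree → Tree
andT a b = ifT a b nil

andᴾ : PolyTime f → PolyTime g → PolyTime (λ d → andT (f d) (g d))
andᴾ F G = ifᴾ F G nilᴾ

-- de Bruijn variables of an environment  cons x₀ (cons x₁ … d)

v₀ : PolyTime hd
v₀ = hdᴾ idᴾ

v₁ : PolyTime (hd ∘ tl)
v₁ = hdᴾ (tlᴾ idᴾ)

weaken : PolyTime f → PolyTime (f ∘ tl)
weaken F = F ∘ᴾ tlᴾ idᴾ

private
  -- The step of a fold sees `cons x (cons acc d)`, while the element functions of `mapᴾ`, `anyᴾ`
  -- and the like expect `cons x d`.
  skip-acc : PolyTime p → PolyTime (λ e → p (cons (hd e) (tl (tl e))))
  skip-acc P = P ∘ᴾ consᴾ v₀ (tlᴾ (tlᴾ idᴾ))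

  size-step : (P : PolyTime p) → ∀ x env →
              size (p (cons x env)) ≤ eval (sizeBound P ⟪ con 1 ⊕ 𝕏 ⟫) (size x + size env)
  size-step P x env = ≤-trans (size-bounded P (cons x env)) (eval-≤-⟪⟫ (sizeBound P) (con 1 ⊕ 𝕏) ≤-refl)

mapT : (Tree → Tree) → Tree → Tree
mapT f = foldrT (λ x acc → cons (f x) acc) nil

mapᴾ : PolyTime p → PolyTime l → PolyTime (λ d → mapT (λ x → p (cons x d)) (l d))
mapᴾ {p} P L = foldrᴾ (consᴾ (skip-acc P) v₁) (con 1 ⊕ sizeBound P ⟪ con 1 ⊕ 𝕏 ⟫) growth nilᴾ L
  where
  growth : Growth (λ e → cons (p (cons (hd e) (tl (tl e)))) (hd (tl e)))
                  (con 1 ⊕ sizeBound P ⟪ con 1 ⊕ 𝕏 ⟫)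
  growth x acc env = begin
    suc (size (p (cons x env)) + size acc)   ≡⟨ cong suc (+-comm _ (size acc)) ⟩
    suc (size acc + size (p (cons x env)))   ≡⟨ sym (+-suc (size acc) _) ⟩
    size acc + suc (size (p (cons x env)))   ≤⟨ +-monoʳ-≤ (size acc) (s≤s (size-step P x env)) ⟩
    size acc + suc _                         ∎
    where open ≤-Reasoning

anyT : (Tree → Tree) → Tree → Tree
anyT p = foldrT (λ x acc → ifT (p x) trueT acc) nil

anyᴾ : PolyTime p → PolyTime l → PolyTime (λ d → anyT (λ x → p (cons x d)) (l d))
-- 3 is the size of `trueT`, the only new value that the accumulator can take.
anyᴾ {p} P L = foldrᴾ (ifᴾ (skip-acc P) trueᴾ v₁) (con 3)
  (λ x acc env → size-ifT (p (cons x env)) (m≤n+m 3 (size acc)) (m≤m+n (size acc) 3)) nilᴾ L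

allT : (Tree → Tree) → Tree → Tree
allT p = foldrT (λ x acc → ifT (p x) acc nil) trueT

allᴾ : PolyTime p → PolyTime l → PolyTime (λ d → allT (λ x → p (cons x d)) (l d))
allᴾ {p} P L = foldrᴾ (ifᴾ (skip-acc P) v₁ nilᴾ) (con 1)
  (λ x acc env → size-ifT (p (cons x env)) (m≤m+n (size acc) 1) (m≤n+m 1 (size acc))) trueᴾ L

appendT : Tree → Tree → Tree
appendT xs ys = foldrT cons ys xs

size-appendT : ∀ xs ys → size (appendT xs ys) ≤ size xs + size ys
size-appendT nil         ys = n≤1+n _
size-appendT (cons x xs) ys = s≤s (≤-trans (+-monoʳ-≤ (size x) (size-appendT xs ys))
                                           (≤-reflexive (sym (+-assoc (size x) _ _))))

appendᴾ : PolyTime f → PolyTime g → PolyTime (λ d → appendT (f d) (g d))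
appendᴾ F G = foldrᴾ (consᴾ v₀ v₁) (con 1 ⊕ 𝕏) growth G F
  where
  growth : Growth (λ e → cons (hd e) (hd (tl e))) (con 1 ⊕ 𝕏)
  growth x acc env = begin
    suc (size x + size acc)               ≡⟨ cong suc (+-comm (size x) (size acc)) ⟩
    suc (size acc + size x)               ≡⟨ sym (+-suc (size acc) _) ⟩
    size acc + suc (size x)               ≤⟨ +-monoʳ-≤ (size acc) (s≤s (m≤m+n (size x) (size env))) ⟩
    size acc + suc (size x + size env)    ∎
    where open ≤-Reasoning

concatMapT : (Tree → Tree) → Tree → Tree
concatMapT f = foldrT (λ x acc → appendT (f x) acc) nil

concatMapᴾ : PolyTime p → PolyTime l → PolyTime (λ d → concatMapT (λ x → p (cons x d)) (l d))
concatMapᴾ {p} P L = foldrᴾ (appendᴾ (skip-acc P) v₁) (sizeBound P ⟪ con 1 ⊕ 𝕏 ⟫)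
  (λ x acc env → ≤-trans (size-appendT (p (cons x env)) acc)
    (≤-trans (≤-reflexive (+-comm _ (size acc))) (+-monoʳ-≤ (size acc) (size-step P x env)))) nilᴾ L

-- Unary arithmetic on trees

appendT-+ : ∀ m n → appendT (encodeℕ m) (encodeℕ n) ≡ encodeℕ (m + n)
appendT-+ zero    n = refl
appendT-+ (suc m) n = cong (cons nil) (appendT-+ m n)

concatMapT-* : ∀ m n → concatMapT (λ _ → encodeℕ n) (encodeℕ m) ≡ encodeℕ (m * n)
concatMapT-* zero    n = refl
concatMapT-* (suc m) n = trans (cong (appendT (encodeℕ n)) (concatMapT-* m n)) (appendT-+ n (m * n))

-- A unary numeral is a list of `nil`, so appending adds and `concatMapT` multiplies. The
-- computability of the factor in the time bound rests on this.
evalT : Poly → Tree → Tree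
evalT 𝕏       d = d
evalT (con c) d = encodeℕ c
evalT (p ⊕ q) d = appendT (evalT p d) (evalT q d)
evalT (p ⊗ q) d = concatMapT (λ _ → evalT q d) (evalT p d)

evalᴾ : ∀ p → PolyTime (evalT p)
evalᴾ 𝕏       = idᴾ
evalᴾ (con c) = constᴾ (encodeℕ c)
evalᴾ (p ⊕ q) = appendᴾ (evalᴾ p) (evalᴾ q)
evalᴾ (p ⊗ q) = concatMapᴾ (weaken (evalᴾ q)) (evalᴾ p)

evalT-eval : ∀ p n → evalT p (encodeℕ n) ≡ encodeℕ (eval p n)
evalT-eval 𝕏       n = refl
evalT-eval (con c) n = refl
evalT-eval (p ⊕ q) n = trans (cong₂ appendT (evalT-eval p n) (evalT-eval q n)) (appendT-+ (eval p n) (eval q n))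
evalT-eval (p ⊗ q) n = trans (cong₂ (λ a b → concatMapT (λ _ → a) b) (evalT-eval q n) (evalT-eval p n))
                             (concatMapT-* (eval p n) (eval q n))

^-distribʳ-* : ∀ m n k → (m * n) ^ k ≡ m ^ k * n ^ k
^-distribʳ-* m n zero    = refl
^-distribʳ-* m n (suc k) = trans (cong (m * n *_) (^-distribʳ-* m n k)) ([m*n]*[o*p]≡[m*o]*[n*p] m n (m ^ k) (n ^ k))

-- Iterated polynomial-time functions

module Iterate {h : Tree → Tree} (H : PolyTime h) where

  open Loop (H ∘ᴾ v₁) public

  -- The summand `𝕏` keeps the bound at least as large as its argument, so the final value of
  -- `iterateBound` also bounds all intermediate accumulators.
  growth : Poly
  growth = 𝕏 ⊕ sizeBound H

  iterateBound : ℕ → ℕ → ℕ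
  iterateBound zero    m = m
  iterateBound (suc n) m = iterateBound n (eval growth m)

  iterateT : ℕ → Tree → Tree
  iterateT zero    a = a
  iterateT (suc n) a = iterateT n (h a)

  foldlT-iterateT : ∀ env n a → foldlT (step env) a (encodeℕ n) ≡ iterateT n a
  foldlT-iterateT env zero    a = refl
  foldlT-iterateT env (suc n) a = foldlT-iterateT env n (h a)

  m≤iterateBound : ∀ n m → m ≤ iterateBound n m
  m≤iterateBound zero    m = ≤-refl
  m≤iterateBound (suc n) m = ≤-trans (m≤m+n m _) (m≤iterateBound n (eval growth m))

  iterate-bounded : ∀ env n {m a} → size a ≤ m → Bounded env (iterateBound n m) a (encodeℕ n)
  iterate-bounded env zero    a≤m = done a≤m
  iterate-bounded env (suc n) {m} {a} a≤m = more (≤-trans a≤m (m≤iterateBound (suc n) m))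
    (iterate-bounded env n (≤-trans (size-bounded H a)
      (≤-trans (eval-mono (sizeBound H) a≤m) (m≤n+m _ m))))

  size-iterateT : ∀ n a → size (iterateT n a) ≤ iterateBound n (size a)
  size-iterateT n a = subst (λ r → size r ≤ iterateBound n (size a)) (foldlT-iterateT nil n a)
    (bounded-result (iterate-bounded nil n ≤-refl))

  iterateTime : Tree → ℕ → Tree → ℕ
  iterateTime env n a = size (encodeℕ n) * (3 + eval (timeBound body)
    (2 + size (encodeℕ n) + iterateBound n (size a) + size env))

  iterate-runs : ∀ env n a σ → σ 0 ≡ cons (encodeℕ n) (cons a env) →
    Run loopᴾ σ (cons nil (cons (iterateT n a) env))
      (iterateTime env n a)
  iterate-runs env n a σ σ0 = subst
    (λ r → Run loopᴾ σ (cons nil (cons r env)) (iterateTime env n a)) (foldlT-iterateT env n a)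
    (loop-runs env _ _ (iterate-bounded env n ≤-refl) ≤-refl σ σ0)

-- A scheme for fixed-parameter time bounds

module _ {h u c : Tree → Tree} (H : PolyTime h) (U : PolyTime u) (a : Tree) (D : PolyTime c) where

  private
    module E = Iterate H
    module Q = Iterate (evalᴾ E.growth)
    m = size a

    iterateT-iterateBound : ∀ n k → Q.iterateT n (encodeℕ k) ≡ encodeℕ (E.iterateBound n k)
    iterateT-iterateBound zero    k = refl
    iterateT-iterateBound (suc n) k =
      trans (cong (Q.iterateT n) (evalT-eval E.growth k)) (iterateT-iterateBound n (eval E.growth k))

    setup : PolyTime (λ d → cons (u d) (cons a d))
    setup = consᴾ U (consᴾ (constᴾ a) idᴾ)

    program : Program
    program = prog setup ⨾ E.loopᴾ ⨾ 0 := `tl (reg 0) ⨾ prog D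

    total : Poly
    total = timeBound setup
          ⊕ (sizeBound U ⊗ (con 3 ⊕ timeBound E.body ⟪ con 2 ⊕ sizeBound U ⊕ 𝕏 ⟫)
          ⊕ (con 3 ⊕ timeBound D ⟪ con 1 ⊕ 𝕏 ⟫))

    C e : ℕ
    C = proj₁ (monomial-bound total)
    e = proj₁ (proj₂ (monomial-bound total))

    power : Poly → ℕ → Poly
    power p zero    = con 1
    power p (suc n) = p ⊗ power p n

    eval-power : ∀ p n x → eval (power p n) x ≡ eval p x ^ n
    eval-power p zero    x = refl
    eval-power p (suc n) x = cong (eval p x *_) (eval-power p n x)

    -- Since `s` is at least 1, `suc (M + s)` is at most `(2 + M) * s`. This splits a polynomial in
    -- `M + s` into a power of `s` and the value of `final` at `M`, the bound on the iterated tree.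
    final : Poly
    final = con C ⊗ power (con 2 ⊕ 𝕏) e

    factor : ℕ → ℕ
    factor n = eval final (E.iterateBound (suc n) m)

    -- `iterateBound` iterates a fixed polynomial, so the same kind of loop, with `evalᴾ` as its
    -- body, computes it on unary numerals.
    factor-computable : Computable factor
    factor-computable = prog counter ⨾ Q.loopᴾ
                      ⨾ 0 := `hd (`tl (reg 0)) ⨾ prog (evalᴾ final)
                      , λ n → computes n (runs counter (start (encodeℕ n)))
      where
      counter : PolyTime (λ d → cons (cons nil d) (cons (encodeℕ m) nil))
      counter = consᴾ (consᴾ nilᴾ idᴾ) (consᴾ (constᴾ (encodeℕ m)) nilᴾ)
      computes : ∀ n {P b} → Run P (start (encodeℕ n)) (cons (encodeℕ (suc n)) (cons (encodeℕ m) nil)) b →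
                 ∃[ t ] ((P ⨾ Q.loopᴾ ⨾ 0 := `hd (`tl (reg 0)) ⨾ prog (evalᴾ final))
                         on encodeℕ n yields encodeℕ (factor n) time t)
      computes n (run {τ} e₁ o₁ _ _) with Q.iterate-runs nil (suc n) (encodeℕ m) τ o₁
      ... | run {υ} e₂ o₂ _ _ with runs (evalᴾ final) (update υ 0 (hd (tl (υ 0))))
      ... | run e₃ o₃ _ _ = _ , _ , seq e₁ (seq e₂ (seq assign e₃)) ,
        trans o₃ (trans (cong (evalT final ∘ hd ∘ tl) o₂)
          (trans (cong (evalT final) (iterateT-iterateBound (suc n) m))
                 (evalT-eval final (E.iterateBound (suc n) m))))

    module _ (d : Tree) (n : ℕ) (u-d : u d ≡ encodeℕ (suc n)) where

      M s L : ℕ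
      M = E.iterateBound (suc n) m
      s = size d
      L = size (encodeℕ (suc n))

      L≤ : L ≤ eval (sizeBound U) s
      L≤ = ≤-trans (≤-reflexive (cong size (sym u-d))) (size-bounded U d)

      L≤′ : L ≤ eval (sizeBound U) (M + s)
      L≤′ = ≤-trans L≤ (eval-mono (sizeBound U) (m≤n+m s M))

      total≤ : eval total (M + s) ≤ factor n * s ^ e
      total≤ = begin
        eval total (M + s)            ≤⟨ proj₂ (proj₂ (monomial-bound total)) (M + s) ⟩
        C * suc (M + s) ^ e           ≤⟨ *-monoʳ-≤ C (^-monoˡ-≤ e suc≤) ⟩
        C * ((2 + M) * s) ^ e         ≡⟨ cong (C *_) (^-distribʳ-* (2 + M) s e) ⟩
        C * ((2 + M) ^ e * s ^ e)     ≡⟨ sym (*-assoc C _ _) ⟩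
        C * (2 + M) ^ e * s ^ e       ≡⟨ cong (λ x → C * x * s ^ e) (sym (eval-power (con 2 ⊕ 𝕏) e M)) ⟩
        factor n * s ^ e              ∎
        where
        open ≤-Reasoning
        suc≤ : suc (M + s) ≤ (2 + M) * s
        suc≤ = begin
          suc M + s            ≡⟨ +-comm (suc M) s ⟩
          s + suc M            ≡⟨ cong (s +_) (sym (*-identityʳ (suc M))) ⟩
          s + suc M * 1        ≤⟨ +-monoʳ-≤ s (*-monoʳ-≤ (suc M) (1≤size d)) ⟩
          s + suc M * s        ∎

      program-runs : ∃[ t ] (program on d yields c (cons (E.iterateT (suc n) a) d) time t
                             × t ≤ factor n * s ^ e)
      program-runs with runs setup (start d)
      ... | run {τ} e₁ o₁ _ b₁ with E.iterate-runs d (suc n) a τ (trans o₁ (cong (λ x → cons x (cons a d)) u-d))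
      ... | run {υ} e₂ o₂ _ b₂ with runs D (update υ 0 (tl (υ 0)))
      ... | run e₃ o₃ _ b₃ = _ ,
        (_ , seq e₁ (seq e₂ (seq assign e₃)) , trans o₃ (cong (c ∘ tl) o₂)) ,
        ≤-trans (+-mono-≤ (≤-trans b₁ (eval-mono (timeBound setup) (m≤n+m s M)))
                (+-mono-≤ (≤-trans b₂ (*-mono-≤ L≤′ (+-monoʳ-≤ 3
                            (eval-≤-⟪⟫ (timeBound E.body) (con 2 ⊕ sizeBound U ⊕ 𝕏)
                              (≤-trans (≤-reflexive (+-assoc (2 + L) M s)) (+-monoˡ-≤ (M + s) (+-monoʳ-≤ 2 L≤′)))))))
                (+-monoʳ-≤ 3 (≤-trans b₃ (eval-≤-⟪⟫ (timeBound D) (con 1 ⊕ 𝕏)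
                  (≤-trans (≤-reflexive (cong (size ∘ tl) o₂))
                    (s≤s (+-monoˡ-≤ s (E.size-iterateT (suc n) a))))))))) total≤

  -- The iteration starts from the constant `a`, so the tree it builds is bounded in terms of `n`
  -- alone. The instance is carried along unchanged and read by `u` and `c`, both polynomial-time.
  fpt-scheme : ∃[ f ] Computable f × (∃[ P ] ∃[ e ] ∀ d n → u d ≡ encodeℕ (suc n) → ∃[ t ]
    ( P on d yields c (cons (Iterate.iterateT H (suc n) a) d) time t
    × t ≤ f n * size d ^ e))
  fpt-scheme = factor , factor-computable , program , e , program-runs

-- Literals, labels and ground atoms

∈-concatMap : ∀ (f : A → List A′) {x xs y} → x ∈ xs → y ∈ f x → y ∈ concatMap f xs
∈-concatMap f x∈xs y∈fx = ∈-concatMap⁺ f (lose x∈xs y∈fx)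

concatMap-∈ : ∀ (f : A → List A′) xs {y} → y ∈ concatMap f xs → ∃[ x ] (x ∈ xs × y ∈ f x)
concatMap-∈ f xs y∈ = find (∈-concatMap⁻ f {xs = xs} y∈)

-- This is the word that `encodeTLit` writes down as a tree, so one program on bit lists compares
-- variables, labels and literals alike.
litBits : TLit → List Bool
litBits ⊥       = []
litBits (var p) = false ∷ p
litBits (□* p)  = true ∷ p

litBits-injective : ∀ {l m} → litBits l ≡ litBits m → l ≡ m
litBits-injective {⊥}     {⊥}      refl = refl
litBits-injective {var p} {var .p} refl = refl
litBits-injective {□* p}  {□* .p}  refl = refl

_≟ˡ_ : DecidableEquality TLit
l ≟ˡ m = map′ litBits-injective (cong litBits) (litBits l ≟ᵛ litBits m)

-- A label stands for the moments k that carry it: its first bit tells whether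
-- k = 0, the others give the truth values of the backdoor variables at k.

Label : Set
Label = List Bool

Atom : Set
Atom = TLit × Label

_≟ᵃ_ : DecidableEquality Atom
(l , ℓ) ≟ᵃ (m , k) = map′ (uncurry (cong₂ _,_)) (λ { refl → refl , refl }) ((l ≟ˡ m) ×-dec (ℓ ≟ᵛ k))

open DecMembership _≟ᵛ_ using () renaming (_∈?_ to _∈ᵛ?_)
open DecMembership _≟ˡ_ using () renaming (_∈?_ to _∈ˡ?_)
open DecMembership _≟ᵃ_ using () renaming (_∈?_ to _∈ᵃ?_)

-- The value of `□* p` does not depend on the moment, so its atom carries the fixed label `[]` and
-- is shared by the instances of a clause at all labels.
ground : Label → TLit → Atom
ground ℓ ⊥       = ⊥ , ℓ
ground ℓ (var p) = var p , ℓ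
ground ℓ (□* p)  = □* p , []

proj₁-ground : ∀ ℓ l → proj₁ (ground ℓ l) ≡ l
proj₁-ground ℓ ⊥       = refl
proj₁-ground ℓ (var p) = refl
proj₁-ground ℓ (□* p)  = refl

isFalsum? : (a : Atom) → Dec (proj₁ a ≡ ⊥)
isFalsum? a = proj₁ a ≟ˡ ⊥

origin : Label → Bool
origin []      = false
origin (b ∷ _) = b

values : Label → List Bool
values []      = []
values (_ ∷ t) = t

-- The accumulator and the treatment of an exhausted word follow the left fold `collectT`, where
-- missing bits read as `nil`, that is, as false.
truths : List Var → List Bool → List Var → List Var
truths []      t           acc = acc
truths (x ∷ X) []          acc = truths X [] acc
truths (x ∷ X) (true  ∷ t) acc = truths X t (x ∷ acc)
truths (x ∷ X) (false ∷ t) acc = truths X t acc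

-- Saturation under ground rules

infix 4 _⇒_

record Rule : Set where
  constructor _⇒_
  field
    premises    : List Atom
    conclusions : List Atom

open Rule public

module Saturation (B : List TLit) where

  -- `B` will be the backdoor literals: the guess fixes their values, and the true ones are present
  -- from the start, so deriving one more would contradict the guess. If no conclusion lies outside
  -- `B`, the default `(⊥ , [])` records this contradiction.
  firstOutside : List Atom → Atom
  firstOutside []      = ⊥ , []
  firstOutside (h ∷ H) = ifᵇ does (proj₁ h ∈ˡ? B) then firstOutside H else h

  derive : List Atom → List Atom → List Atom
  derive H D = ifᵇ does (any? (_∈ᵃ? D) H) then D else firstOutside H ∷ D

  -- Rules that have fired are dropped, so that the number of passes needed to
  -- reach a fixed point is at most the number of rules.

  fire : Rule → List Rule × List Atom → List Rule × List Atom
  fire r (rs , D) =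
    ifᵇ does (all? (_∈ᵃ? D) (premises r)) then (rs , derive (conclusions r) D) else (r ∷ rs , D)

  pass : List Rule → List Atom → List Rule × List Atom
  pass []       D = [] , D
  pass (r ∷ rs) D = fire r (pass rs D)

  -- Only the length of `fuel` counts; it is a list because the program uses the list of rules
  -- itself as its loop counter.
  saturate : List Rule → List Rule × List Atom → List Rule × List Atom
  saturate []         s        = s
  saturate (_ ∷ fuel) (rs , D) = saturate fuel (pass rs D)

  firstOutside-spec : ∀ H → (All (λ h → proj₁ h ∈ B) H × firstOutside H ≡ (⊥ , []))
                          ⊎ (firstOutside H ∈ H × proj₁ (firstOutside H) ∉ B)
  firstOutside-spec [] = inj₁ ([] , refl)
  firstOutside-spec (h ∷ H) with proj₁ h ∈ˡ? B
  ... | no h∉B = inj₂ (here refl , h∉B)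
  ... | yes h∈B with firstOutside-spec H
  ...   | inj₁ (H⊆B , eq) = inj₁ (h∈B ∷ H⊆B , eq)
  ...   | inj₂ (∈H , ∉B)  = inj₂ (there ∈H , ∉B)

  Fireable Settled : List Atom → Rule → Set
  Fireable D r = All (_∈ D) (premises r)
  Settled D r = Any (λ a → proj₁ a ≡ ⊥) D ⊎ Any (_∈ D) (conclusions r)

  settled-mono : ∀ {D D′ r} → D ⊆ D′ → Settled D r → Settled D′ r
  settled-mono D⊆D′ (inj₁ falsum) = let _ , a∈D , eq = find falsum in inj₁ (lose (D⊆D′ a∈D) eq)
  settled-mono D⊆D′ (inj₂ holds)  = inj₂ (Any.map D⊆D′ holds)

  derive-⊇ : ∀ H D → D ⊆ derive H D
  derive-⊇ H D with any? (_∈ᵃ? D) H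
  ... | yes _ = id
  ... | no  _ = there

  derive-settles : ∀ r D → Settled (derive (conclusions r) D) r
  derive-settles r D with any? (_∈ᵃ? D) (conclusions r)
  ... | yes holds = inj₂ holds
  ... | no  _ with firstOutside-spec (conclusions r)
  ...   | inj₁ (_ , eq) = inj₁ (here (cong proj₁ eq))
  ...   | inj₂ (∈H , _) = inj₂ (lose ∈H (here refl))

  -- The invariant that justifies dropping rules: a rule leaves the list only when it becomes
  -- settled, and it stays settled because `D` only grows.
  Pending : List Rule × List Atom → Rule → Set
  Pending (rs , D) r = r ∈ rs ⊎ Settled D r

  fire-pending : ∀ r s {q} → (q ≡ r ⊎ Pending s q) → Pending (fire r s) q
  fire-pending r (rs , D) {q} p with all? (_∈ᵃ? D) (premises r) | p
  ... | yes _ | inj₁ refl             = inj₂ (derive-settles r D)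
  ... | yes _ | inj₂ (inj₁ q∈rs)      = inj₁ q∈rs
  ... | yes _ | inj₂ (inj₂ settled)   = inj₂ (settled-mono {r = q} (derive-⊇ (conclusions r) D) settled)
  ... | no  _ | inj₁ refl             = inj₁ (here refl)
  ... | no  _ | inj₂ (inj₁ q∈rs)      = inj₁ (there q∈rs)
  ... | no  _ | inj₂ (inj₂ settled)   = inj₂ settled

  pass-pending : ∀ rs D {q} → Pending (rs , D) q → Pending (pass rs D) q
  pass-pending []       D p                     = p
  pass-pending (r ∷ rs) D (inj₁ (here q≡r))     = fire-pending r (pass rs D) (inj₁ q≡r)
  pass-pending (r ∷ rs) D (inj₁ (there q∈rs))   = fire-pending r (pass rs D) (inj₂ (pass-pending rs D (inj₁ q∈rs)))
  pass-pending (r ∷ rs) D (inj₂ settled)        = fire-pending r (pass rs D) (inj₂ (pass-pending rs D (inj₂ settled)))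

  saturate-pending : ∀ fuel s {q} → Pending s q → Pending (saturate fuel s) q
  saturate-pending []         s        p = p
  saturate-pending (_ ∷ fuel) (rs , D) p = saturate-pending fuel (pass rs D) (pass-pending rs D p)

  Stable : List Rule × List Atom → Set
  Stable (rs , D) = All (¬_ ∘ Fireable D) rs

  stable-pass : ∀ rs D → All (¬_ ∘ Fireable D) rs → pass rs D ≡ (rs , D)
  stable-pass []       D []           = refl
  stable-pass (r ∷ rs) D (¬r ∷ ¬rs) rewrite stable-pass rs D ¬rs with all? (_∈ᵃ? D) (premises r)
  ... | yes fireable = contradiction fireable ¬r
  ... | no  _        = refl

  stable-saturate : ∀ fuel s → Stable s → Stable (saturate fuel s)
  stable-saturate []         s        st = st
  stable-saturate (_ ∷ fuel) (rs , D) st =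
    stable-saturate fuel (pass rs D) (subst Stable (sym (stable-pass rs D st)) st)

  -- Atoms are added only by rules that fire, and these are dropped. So a pass that drops nothing
  -- has derived nothing and is a fixed point.
  pass-progress : ∀ rs D → length (proj₁ (pass rs D)) < length rs
                         ⊎ (All (¬_ ∘ Fireable D) rs × pass rs D ≡ (rs , D))
  pass-progress []       D = inj₂ ([] , refl)
  pass-progress (r ∷ rs) D with pass rs D | pass-progress rs D
  ... | rs′ , D′ | progress with all? (_∈ᵃ? D′) (premises r)
  ...   | yes _  = inj₁ (s≤s ([ <⇒≤ , (λ { (_ , refl) → ≤-refl }) ]′ progress))
  ...   | no ¬r with progress
  ...     | inj₁ shorter         = inj₁ (s≤s shorter)
  ...     | inj₂ (¬rs , refl) = inj₂ (¬r ∷ ¬rs , refl)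

  -- Each pass before the fixed point removes a rule, so the fuel cannot run out while rules are
  -- left.
  saturate-stable : ∀ fuel rs D → length rs ≤ length fuel → Stable (saturate fuel (rs , D))
  saturate-stable []         []  D z≤n = []
  saturate-stable (_ ∷ fuel) rs  D rs≤ with pass-progress rs D
  ... | inj₁ shorter        = saturate-stable fuel _ _ (≤-pred (≤-trans shorter rs≤))
  ... | inj₂ (¬rs , eq)  = stable-saturate fuel (pass rs D) (subst Stable (sym eq) ¬rs)

  saturated : ∀ rs D {r} → r ∈ rs → let D′ = proj₂ (saturate rs (rs , D)) in
              Fireable D′ r → Settled D′ r
  saturated rs D r∈rs fireable with saturate-pending rs (rs , D) (inj₁ r∈rs)
  ... | inj₂ settled = settled
  ... | inj₁ r∈rest  = contradiction fireable (All.lookup (saturate-stable rs rs D ≤-refl) r∈rest)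

  fire-⊆ : ∀ r s → proj₁ (fire r s) ⊆ r ∷ proj₁ s
  fire-⊆ r (rs , D) with all? (_∈ᵃ? D) (premises r)
  ... | yes _ = there
  ... | no  _ = id

  pass-⊆ : ∀ rs D → proj₁ (pass rs D) ⊆ rs
  pass-⊆ (r ∷ rs) D q∈ with fire-⊆ r (pass rs D) q∈
  ... | here q≡r = here q≡r
  ... | there q∈′ = there (pass-⊆ rs D q∈′)

  module _ (I : List Atom → Set) where

    -- `D` changes only when a rule fires with none of its conclusions present, so an invariant has
    -- to be checked there alone. `R` stays fixed while the working list of rules shrinks.
    derive-invariant : List Rule → Set
    derive-invariant R = ∀ {r D} → r ∈ R → I D → Fireable D r → ¬ Any (_∈ D) (conclusions r) →
                         I (firstOutside (conclusions r) ∷ D)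

    fire-preserves : ∀ {R} → derive-invariant R → ∀ {r} s → r ∈ R → I (proj₂ s) → I (proj₂ (fire r s))
    fire-preserves inv {r} (rs , D) r∈R i with all? (_∈ᵃ? D) (premises r)
    ... | no  _ = i
    ... | yes fireable with any? (_∈ᵃ? D) (conclusions r)
    ...   | yes _    = i
    ...   | no  ¬any = inv r∈R i fireable ¬any

    pass-preserves : ∀ {R} → derive-invariant R → ∀ rs D → rs ⊆ R → I D → I (proj₂ (pass rs D))
    pass-preserves inv []       D rs⊆R i = i
    pass-preserves inv (r ∷ rs) D rs⊆R i =
      fire-preserves inv (pass rs D) (rs⊆R (here refl)) (pass-preserves inv rs D (rs⊆R ∘ there) i)

    saturate-preserves : ∀ {R} → derive-invariant R → ∀ fuel rs D → rs ⊆ R → I D →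
                         I (proj₂ (saturate fuel (rs , D)))
    saturate-preserves inv []         rs D rs⊆R i = i
    saturate-preserves inv (_ ∷ fuel) rs D rs⊆R i =
      saturate-preserves inv fuel _ _ (rs⊆R ∘ pass-⊆ rs D) (pass-preserves inv rs D rs⊆R i)

-- The algorithm

litVar : TLit → Var
litVar ⊥       = []
litVar (var p) = p
litVar (□* p)  = p

-- The placeholder `[]` that `litVar` gives for `⊥` may add a variable that does not occur. This is
-- harmless: the rules for □* are sound for it as well.
letters : Formula → List Var
letters φ = concatMap (λ c → map litVar (neg c) ++ map litVar (pos c)) (clauses φ)

-- A set of words of length n + 1 is a pair of sets of words of length n, split by the first bit.
-- Hence `extendGuesses` squares the number of guesses, starting from two.
merge : List Label → List Label → List Label
merge S T = map (true ∷_) S ++ map (false ∷_) T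

extendGuesses : List (List Label) → List (List Label)
extendGuesses Gs = concatMap (λ S → map (merge S) Gs) Gs

guesses₀ : List (List Label)
guesses₀ = [] ∷ ([] ∷ []) ∷ []

guesses : ℕ → List (List Label)
guesses zero    = guesses₀
guesses (suc n) = extendGuesses (guesses n)

module Algorithm (φ : Formula) (X : List Var) where

  backdoorLits : List TLit
  backdoorLits = concatMap (λ x → var x ∷ □* x ∷ []) X

  open Saturation backdoorLits public

  clauseRule : Label → Clause → Rule
  clauseRule ℓ c = map (ground ℓ) (neg c) ⇒ map (ground ℓ) (pos c)

  initialRule : Label → Var → Rule
  initialRule ℓ p = [] ⇒ (var p , ℓ) ∷ []

  □-elim : Label → Var → Rule
  □-elim ℓ p = (□* p , []) ∷ [] ⇒ (var p , ℓ) ∷ []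

  □-intro : List Label → Var → Rule
  □-intro G p = map (λ ℓ → var p , ℓ) G ⇒ (□* p , []) ∷ []

  rulesAt : Label → List Rule
  rulesAt ℓ = (ifᵇ origin ℓ then map (initialRule ℓ) (initial φ) else [])
           ++ map (clauseRule ℓ) (clauses φ) ++ map (□-elim ℓ) (letters φ)

  rules : List Label → List Rule
  rules G = concatMap rulesAt G ++ map (□-intro G) (letters φ)

  nowFacts : List Label → List Atom
  nowFacts G = concatMap (λ ℓ → map (λ x → var x , ℓ) (truths X (values ℓ) [])) G

  -- If `G` consists of the labels that occur, `□* x` holds exactly when `x` is true at all of them,
  -- so boxed backdoor literals need no bits of their own.
  alwaysFact : List Label → Var → List Atom
  alwaysFact G x = ifᵇ does (all? (λ ℓ → (var x , ℓ) ∈ᵃ? nowFacts G) G) then (□* x , []) ∷ [] else []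

  facts : List Label → List Atom
  facts G = nowFacts G ++ concatMap (alwaysFact G) X

  closure : List Label → List Atom
  closure G = proj₂ (saturate (rules G) (rules G , facts G))

  Accepts : List Label → Set
  Accepts G = Any (λ ℓ → origin ℓ ≡ true) G × ¬ Any (λ a → proj₁ a ≡ ⊥) (closure G)

  accepts? : ∀ G → Dec (Accepts G)
  accepts? G = any? (λ ℓ → origin ℓ Bool.≟ true) G ×-dec ¬? (any? isFalsum? (closure G))

  initialRule∈ : ∀ {G ℓ p} → ℓ ∈ G → origin ℓ ≡ true → p ∈ initial φ → initialRule ℓ p ∈ rules G
  initialRule∈ {ℓ = true ∷ _} ℓ∈G refl p∈ =
    ∈-++⁺ˡ (∈-concatMap rulesAt ℓ∈G (∈-++⁺ˡ (∈-map⁺ (initialRule _) p∈)))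

  clauseRule∈ : ∀ {G ℓ c} → ℓ ∈ G → c ∈ clauses φ → clauseRule ℓ c ∈ rules G
  clauseRule∈ {ℓ = ℓ} ℓ∈G c∈ = ∈-++⁺ˡ (∈-concatMap rulesAt ℓ∈G
    (∈-++⁺ʳ (ifᵇ origin ℓ then _ else _) (∈-++⁺ˡ (∈-map⁺ (clauseRule ℓ) c∈))))

  □-elim∈ : ∀ {G ℓ p} → ℓ ∈ G → p ∈ letters φ → □-elim ℓ p ∈ rules G
  □-elim∈ {ℓ = ℓ} ℓ∈G p∈ = ∈-++⁺ˡ (∈-concatMap rulesAt ℓ∈G
    (∈-++⁺ʳ (ifᵇ origin ℓ then _ else _) (∈-++⁺ʳ (map (clauseRule ℓ) (clauses φ)) (∈-map⁺ (□-elim ℓ) p∈))))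

  □-intro∈ : ∀ {G p} → p ∈ letters φ → □-intro G p ∈ rules G
  □-intro∈ {G} p∈ = ∈-++⁺ʳ (concatMap rulesAt G) (∈-map⁺ (□-intro G) p∈)

  data RuleOf (G : List Label) : Rule → Set where
    initialʳ : ∀ {ℓ p} → ℓ ∈ G → origin ℓ ≡ true → p ∈ initial φ → RuleOf G (initialRule ℓ p)
    clauseʳ  : ∀ {ℓ c} → ℓ ∈ G → c ∈ clauses φ → RuleOf G (clauseRule ℓ c)
    elimʳ    : ∀ {ℓ p} → ℓ ∈ G → p ∈ letters φ → RuleOf G (□-elim ℓ p)
    introʳ   : ∀ {p} → p ∈ letters φ → RuleOf G (□-intro G p)

  ruleAt-of : ∀ {G ℓ r} → ℓ ∈ G → r ∈ rulesAt ℓ → RuleOf G r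
  ruleAt-of {ℓ = ℓ} ℓ∈G r∈ with ∈-++⁻ (ifᵇ origin ℓ then map (initialRule ℓ) (initial φ) else []) r∈
  ruleAt-of {ℓ = true ∷ _} ℓ∈G r∈ | inj₁ r∈ᵢ with ∈-map⁻ _ r∈ᵢ
  ... | p , p∈ , refl = initialʳ ℓ∈G refl p∈
  ruleAt-of {ℓ = ℓ} ℓ∈G r∈ | inj₂ r∈′ with ∈-++⁻ (map (clauseRule ℓ) (clauses φ)) r∈′
  ... | inj₁ r∈ᶜ with ∈-map⁻ _ r∈ᶜ
  ...   | c , c∈ , refl = clauseʳ ℓ∈G c∈
  ruleAt-of {ℓ = ℓ} ℓ∈G r∈ | inj₂ r∈′ | inj₂ r∈ᵉ with ∈-map⁻ _ r∈ᵉ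
  ... | p , p∈ , refl = elimʳ ℓ∈G p∈

  rule-of : ∀ {G r} → r ∈ rules G → RuleOf G r
  rule-of {G} r∈ with ∈-++⁻ (concatMap rulesAt G) r∈
  ... | inj₁ r∈ₐ = let ℓ , ℓ∈G , r∈ℓ = concatMap-∈ rulesAt G r∈ₐ in ruleAt-of ℓ∈G r∈ℓ
  ... | inj₂ r∈ᵢ with ∈-map⁻ _ r∈ᵢ
  ...   | p , p∈ , refl = introʳ p∈

letter∈ : ∀ {φ c l} → c ∈ clauses φ → l ∈ neg c ⊎ l ∈ pos c → litVar l ∈ letters φ
letter∈ {c = c} c∈ (inj₁ l∈) = ∈-concatMap _ c∈ (∈-++⁺ˡ (∈-map⁺ litVar l∈))
letter∈ {c = c} c∈ (inj₂ l∈) = ∈-concatMap _ c∈ (∈-++⁺ʳ (map litVar (neg c)) (∈-map⁺ litVar l∈))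

does-true : ∀ {P : Set} (d : Dec P) → does d ≡ true → P
does-true (yes p) _ = p

-- Soundness

nth : Label → List Label → ℕ → Label
nth ℓ₀ []      _       = ℓ₀
nth ℓ₀ (ℓ ∷ G) zero    = ℓ
nth ℓ₀ (ℓ ∷ G) (suc n) = nth ℓ₀ G n

nth-∈ : ∀ {ℓ₀ G₀} G n → ℓ₀ ∈ G₀ → G ⊆ G₀ → nth ℓ₀ G n ∈ G₀
nth-∈ []      n       ℓ₀∈ G⊆ = ℓ₀∈
nth-∈ (ℓ ∷ G) zero    ℓ₀∈ G⊆ = G⊆ (here refl)
nth-∈ (ℓ ∷ G) (suc n) ℓ₀∈ G⊆ = nth-∈ G n ℓ₀∈ (G⊆ ∘ there)

nth-onto : ∀ {ℓ₀ ℓ G} → ℓ ∈ G → ∃[ n ] nth ℓ₀ G n ≡ ℓ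
nth-onto (here refl) = 0 , refl
nth-onto (there ℓ∈G) = let n , eq = nth-onto ℓ∈G in suc n , eq

-- Moment 0 must carry a label with the origin bit, and every label of `G` must occur, since the
-- premises of `□-intro` range over all of `G`. Other moments may carry an origin label too; the
-- initial variables then simply hold there as well.
point : Label → List Label → ℤ → Label
point ℓ₀ G (ℤ.+ zero)  = ℓ₀
point ℓ₀ G (ℤ.+ suc n) = nth ℓ₀ G n
point ℓ₀ G -[1+ n ]  = ℓ₀

module Soundness (φ : Formula) (X : List Var) (G : List Label) where

  open Algorithm φ X

  module _ {ℓ₀ : Label} (ℓ₀∈G : ℓ₀ ∈ G) (ℓ₀-origin : origin ℓ₀ ≡ true)
           (D : List Atom) (⊥∉D : ¬ Any (λ a → proj₁ a ≡ ⊥) D)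
           (closed : ∀ {r} → r ∈ rules G → Fireable D r → Settled D r) where

    V : Interpretation
    V p k = (var p , point ℓ₀ G k) ∈ D

    point∈G : ∀ k → point ℓ₀ G k ∈ G
    point∈G (ℤ.+ zero)  = ℓ₀∈G
    point∈G (ℤ.+ suc n) = nth-∈ G n ℓ₀∈G id
    point∈G -[1+ n ]  = ℓ₀∈G

    conclude : ∀ {r} → r ∈ rules G → Fireable D r → Any (_∈ D) (conclusions r)
    conclude r∈ fireable with closed r∈ fireable
    ... | inj₁ falsum = contradiction falsum ⊥∉D
    ... | inj₂ holds  = holds

    conclude₁ : ∀ {B a} → (B ⇒ a ∷ []) ∈ rules G → All (_∈ D) B → a ∈ D
    conclude₁ r∈ fireable with conclude r∈ fireable
    ... | here a∈D = a∈D

    □-sound : ∀ {p} → p ∈ letters φ → (□* p , []) ∈ D → ∀ k → V p k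
    □-sound p∈ □p∈D k = conclude₁ (□-elim∈ (point∈G k) p∈) (□p∈D ∷ [])

    □-complete : ∀ {p} → p ∈ letters φ → (∀ k → V p k) → (□* p , []) ∈ D
    □-complete {p} p∈ always = conclude₁ (□-intro∈ p∈) (All.map⁺ (All.tabulate λ ℓ∈G →
      -- Position `n` of `G` is the label of moment `suc n`, so truth at all moments covers every
      -- label of `G`.
      let n , eq = nth-onto ℓ∈G in subst (λ ℓ → (var p , ℓ) ∈ D) eq (always (ℤ.+ suc n))))

    lit-sound : ∀ k l → litVar l ∈ letters φ → ground (point ℓ₀ G k) l ∈ D → V , k ⊨ˡ l
    lit-sound k ⊥       _  ⊥∈D  = ⊥∉D (lose ⊥∈D refl)
    lit-sound k (var p) _  p∈D  = p∈D
    lit-sound k (□* p)  p∈ □p∈D = □-sound p∈ □p∈D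

    lit-complete : ∀ k l → litVar l ∈ letters φ → V , k ⊨ˡ l → ground (point ℓ₀ G k) l ∈ D
    lit-complete k (var p) _  p∈D    = p∈D
    lit-complete k (□* p)  p∈ always = □-complete p∈ always

    clause-holds : ∀ k {c} → c ∈ clauses φ → V , k ⊨ᶜ c
    clause-holds k {c} c∈ with all? (_∈ᵃ? D) (map (ground (point ℓ₀ G k)) (neg c))
    ... | no ¬all = inj₁ (fails (Any.map⁻ (All.¬All⇒Any¬ (_∈ᵃ? D) _ ¬all)))
      where
      fails : Any (λ l → ground (point ℓ₀ G k) l ∉ D) (neg c) → Any (λ l → ¬ (V , k ⊨ˡ l)) (neg c)
      fails any with find any
      ... | l , l∈ , l∉D = lose l∈ (l∉D ∘ lit-complete k l (letter∈ {φ} c∈ (inj₁ l∈)))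
    ... | yes all with find (Any.map⁻ (conclude (clauseRule∈ (point∈G k) c∈) all))
    ...   | l , l∈ , l∈D = inj₂ (lose l∈ (lit-sound k l (letter∈ {φ} c∈ (inj₂ l∈)) l∈D))

    model : Satisfiable φ
    model = V , All.tabulate (λ p∈ → conclude₁ (initialRule∈ ℓ₀∈G ℓ₀-origin p∈) [])
              , λ k → All.tabulate (clause-holds k)

  accepts-sound : Accepts G → Satisfiable φ
  accepts-sound (origins , ⊥∉) with find origins
  ... | ℓ₀ , ℓ₀∈G , ℓ₀-origin = model ℓ₀∈G ℓ₀-origin (closure G) ⊥∉ (saturated (rules G) (facts G))

-- Completeness

truth : (ℤ → Var → Bool) → (Var → Bool) → ℤ → TLit → Bool
truth χ β k ⊥       = false
truth χ β k (var p) = χ k p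
truth χ β k (□* p)  = β p

-- The part of a model that matters, with decidable truth values.

record BoolModel (φ : Formula) : Set where
  field
    χ         : ℤ → Var → Bool
    β         : Var → Bool
    initially : ∀ {p} → p ∈ initial φ → χ 0ℤ p ≡ true
    holds     : ∀ k {c} → c ∈ clauses φ →
                Any (λ l → truth χ β k l ≡ false) (neg c) ⊎ Any (λ l → truth χ β k l ≡ true) (pos c)
    β⇒χ       : ∀ {p} → β p ≡ true → ∀ k → χ k p ≡ true
    χ⇒β       : ∀ {p} → p ∈ letters φ → (∀ k → χ k p ≡ true) → β p ≡ true

module _ {φ : Formula} {V : Interpretation} (V⊨φ : V , 0ℤ ⊨ φ) where

  -- A proof of `V , k ⊨ᶜ c` names the literal that satisfies `c`. Whether this is the positive
  -- literal `var p` is decidable even when `V p k` is not.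
  Chosen : Var → ∀ {k c} → V , k ⊨ᶜ c → Set
  Chosen p (inj₁ _)  = Empty
  Chosen p (inj₂ ls) = Any.lookup ls ≡ var p

  chosen? : ∀ p {k c} (s : V , k ⊨ᶜ c) → Dec (Chosen p s)
  chosen? p (inj₁ _)  = no λ()
  chosen? p (inj₂ ls) = Any.lookup ls ≟ˡ var p

  chosen-true : ∀ {p k c} (s : V , k ⊨ᶜ c) → Chosen p s → V p k
  chosen-true {k = k} (inj₂ ls) eq = subst (V , k ⊨ˡ_) eq (Any.lookup-result ls)

  ChosenAny : Var → ∀ {k cs} → All (V , k ⊨ᶜ_) cs → Set
  ChosenAny p []       = Empty
  ChosenAny p (s ∷ ss) = Chosen p s ⊎ ChosenAny p ss

  chosenAny? : ∀ p {k cs} (ss : All (V , k ⊨ᶜ_) cs) → Dec (ChosenAny p ss)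
  chosenAny? p []       = no λ()
  chosenAny? p (s ∷ ss) = chosen? p s ⊎-dec chosenAny? p ss

  chosenAny-true : ∀ {p k cs} (ss : All (V , k ⊨ᶜ_) cs) → ChosenAny p ss → V p k
  chosenAny-true (s ∷ ss) (inj₁ ch) = chosen-true s ch
  chosenAny-true (s ∷ ss) (inj₂ ch) = chosenAny-true ss ch

  chosen-any : ∀ {p k cs c} (ss : All (V , k ⊨ᶜ_) cs) (c∈ : c ∈ cs) →
               Chosen p (All.lookup ss c∈) → ChosenAny p ss
  chosen-any (s ∷ ss) (here refl) ch = inj₁ ch
  chosen-any (s ∷ ss) (there c∈)  ch = inj₂ (chosen-any ss c∈ ch)

  module _ (□? : All (λ p → Dec (∀ k → V p k)) (letters φ)) where

    -- Decisions are at hand for the finitely many letters only; any other variable counts as not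
    -- always true, whatever `V` says.
    Always : Var → Set
    Always p = ∃[ p∈ ] does (All.lookup □? {p} p∈) ≡ true

    always? : ∀ ps (ds : All (λ p → Dec (∀ k → V p k)) ps) p →
              Dec (∃[ p∈ ] does (All.lookup ds {p} p∈) ≡ true)
    always? []       []       p = no λ ()
    always? (q ∷ ps) (d ∷ ds) p = map′
      [ (λ { (refl , eq) → here refl , eq }) , (λ { (p∈ , eq) → there p∈ , eq }) ]′
      (λ { (here refl , eq) → inj₁ (refl , eq) ; (there p∈ , eq) → inj₂ (p∈ , eq) })
      (first ⊎-dec always? ps ds p)
      where
      first : Dec (p ≡ q × does d ≡ true)
      first = (p ≟ᵛ q) ×-dec (does d Bool.≟ true)

    always-true : ∀ {p} → Always p → ∀ k → V p k
    always-true (p∈ , eq) with All.lookup □? p∈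
    ... | yes □p = □p

    always-decided : ∀ {p} → p ∈ letters φ → (∀ k → V p k) → Always p
    always-decided p∈ □p = p∈ , dec-true (All.lookup □? p∈) □p

    -- V itself need not be decidable; the variables whose truth at k is used
    -- to satisfy φ are.

    Now : ℤ → Var → Set
    Now k p = Always p ⊎ (k ≡ 0ℤ × p ∈ initial φ) ⊎ ChosenAny p (proj₂ V⊨φ k)

    now? : ∀ k p → Dec (Now k p)
    now? k p = always? _ □? p ⊎-dec (((k ℤ.≟ 0ℤ) ×-dec (p ∈ᵛ? initial φ)) ⊎-dec chosenAny? p (proj₂ V⊨φ k))

    now-true : ∀ {k p} → Now k p → V p k
    now-true {k}     (inj₁ □p)                    = always-true □p k
    now-true         (inj₂ (inj₁ (refl , p∈)))    = All.lookup (proj₁ V⊨φ) p∈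
    now-true {k} {p} (inj₂ (inj₂ ch))             = chosenAny-true (proj₂ V⊨φ k) ch

    boolModel : BoolModel φ
    boolModel = record
      { χ         = χ
      ; β         = β
      ; initially = λ {p} p∈ → dec-true (now? 0ℤ p) (inj₂ (inj₁ (refl , p∈)))
      ; holds     = λ k c∈ → holds′ k c∈ (All.lookup (proj₂ V⊨φ k) c∈) refl
      ; β⇒χ       = λ {p} eq k → dec-true (now? k p) (inj₁ (does-true (always? _ □? p) eq))
      ; χ⇒β       = λ {p} p∈ now → dec-true (always? _ □? p)
                       (always-decided p∈ λ k → now-true (does-true (now? k p) (now k)))
      }
      where
      χ : ℤ → Var → Bool
      χ k p = does (now? k p)
      β : Var → Bool
      β p = does (always? _ □? p)
      -- `χ` and `β` make true only what `V` makes true, so negated literals that hold in `V` still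
      -- hold.
      falsified : ∀ k l → ¬ (V , k ⊨ˡ l) → truth χ β k l ≡ false
      falsified k ⊥       _ = refl
      falsified k (var p) ¬p = dec-false (now? k p) (¬p ∘ now-true)
      falsified k (□* p)  ¬p = dec-false (always? _ □? p) (¬p ∘ always-true)
      holds′ : ∀ k {c} (c∈ : c ∈ clauses φ) (s : V , k ⊨ᶜ c) → All.lookup (proj₂ V⊨φ k) c∈ ≡ s →
               Any (λ l → truth χ β k l ≡ false) (neg c) ⊎ Any (λ l → truth χ β k l ≡ true) (pos c)
      holds′ k c∈ (inj₁ ls) eq = inj₁ (Any.map (λ {l} → falsified k l) ls)
      holds′ k {c} c∈ (inj₂ ls) eq = inj₂ (lose (∈-lookup (Any.index ls))
        (truthful (Any.lookup ls) refl (Any.lookup-result ls)))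
        where
        truthful : ∀ l → Any.lookup ls ≡ l → V , k ⊨ˡ l → truth χ β k l ≡ true
        -- `eq` identifies `inj₂ ls` with the proof stored in `V⊨φ`, to which `ChosenAny` refers.
        truthful (var p) l≡ _  = dec-true (now? k p) (inj₂ (inj₂ (chosen-any (proj₂ V⊨φ k) c∈
                                   (subst (Chosen p) (sym eq) l≡))))
        truthful (□* p)  l≡ □p = dec-true (always? _ □? p) (always-decided
                                   (letter∈ {φ} c∈ (inj₂ (subst (_∈ pos c) l≡ (∈-lookup (Any.index ls))))) □p)

-- Whether a label occurs is a question about all of ℤ and has no decision procedure here. But there
-- are only finitely many words of length `n`, so excluded middle can be used for each of them under
-- one double negation.
guess-exists : ∀ n (P : Label → Set) → ¬ ¬ (∃[ G ] (G ∈ guesses n × (∀ {ℓ} → ℓ ∈ G → P ℓ)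
                                                    × (∀ {ℓ} → length ℓ ≡ n → P ℓ → ℓ ∈ G)))
guess-exists zero P ¬guess = ¬¬-excluded-middle λ where
  (yes P[]) → ¬guess ([] ∷ [] , there (here refl) , (λ { (here refl) → P[] }) , λ { {[]} _ _ → here refl })
  (no ¬P[]) → ¬guess ([] , here refl , (λ ()) , λ { {[]} _ P[] → contradiction P[] ¬P[] })
guess-exists (suc n) P ¬guess =
  guess-exists n (P ∘ (true ∷_)) λ (S , S∈ , S⊆P , P⊆S) →
  guess-exists n (P ∘ (false ∷_)) λ (T , T∈ , T⊆P , P⊆T) →
  ¬guess (merge S T , ∈-concatMap _ S∈ (∈-map⁺ (merge S) T∈)
         , (λ ℓ∈ → [ (λ ℓ∈S → let ℓ , ℓ∈ , eq = ∈-map⁻ (true ∷_) ℓ∈S in subst P (sym eq) (S⊆P ℓ∈))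
                   , (λ ℓ∈T → let ℓ , ℓ∈ , eq = ∈-map⁻ (false ∷_) ℓ∈T in subst P (sym eq) (T⊆P ℓ∈))
                   ]′ (∈-++⁻ (map (true ∷_) S) ℓ∈))
         , λ { {true  ∷ ℓ} len Pℓ → ∈-++⁺ˡ (∈-map⁺ (true ∷_) (P⊆S (suc-injective len) Pℓ))
             ; {false ∷ ℓ} len Pℓ → ∈-++⁺ʳ (map (true ∷_) S) (∈-map⁺ (false ∷_) (P⊆T (suc-injective len) Pℓ)) })

truths-⊇ : ∀ X t {acc} → acc ⊆ truths X t acc
truths-⊇ []      t           = id
truths-⊇ (x ∷ X) []          = truths-⊇ X []
truths-⊇ (x ∷ X) (true  ∷ t) = truths-⊇ X t ∘ there
truths-⊇ (x ∷ X) (false ∷ t) = truths-⊇ X t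

truths-complete : ∀ (χ : Var → Bool) X {x acc} → x ∈ X → χ x ≡ true → x ∈ truths X (map χ X) acc
truths-complete χ (y ∷ X) (here refl) χx rewrite χx = truths-⊇ X (map χ X) (here refl)
truths-complete χ (y ∷ X) (there x∈X) χx with χ y
... | true  = truths-complete χ X x∈X χx
... | false = truths-complete χ X x∈X χx

truths-sound : ∀ (χ : Var → Bool) X {x acc} → x ∈ truths X (map χ X) acc → x ∈ acc ⊎ χ x ≡ true
truths-sound χ []      x∈ = inj₁ x∈
truths-sound χ (y ∷ X) x∈ with χ y in eq
... | false = truths-sound χ X x∈
... | true with truths-sound χ X x∈
...   | inj₁ (here refl) = inj₂ eq
...   | inj₁ (there x∈acc) = inj₁ x∈acc
...   | inj₂ χx = inj₂ χx

at-most-one : ∀ {A : Set} {xs : List A} {x y} → length xs ≤ 1 → x ∈ xs → y ∈ xs → x ≡ y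
at-most-one {xs = _ ∷ []} _ (here refl) (here refl) = refl
at-most-one {xs = _ ∷ _ ∷ _} (s≤s ()) _ _

matrixVars⊆letters : ∀ φ → matrixVars φ ⊆ letters φ
matrixVars⊆letters φ {x} x∈ with concatMap-∈ clauseVars (clauses φ) x∈
... | c , c∈ , x∈c with concatMap-∈ litVars (neg c ++ pos c) x∈c
...   | l , l∈ , x∈l = subst (_∈ letters φ) (sym (is-litVar l x∈l)) (letter∈ {φ} c∈ (∈-++⁻ (neg c) l∈))
  where
  is-litVar : ∀ l → x ∈ litVars l → x ≡ litVar l
  is-litVar (var p) (here eq) = eq
  is-litVar (□* p)  (here eq) = eq

∈-replaceEmptyFormula : ∀ {cs c} → c ∈ cs → c ∈ replaceEmptyFormula cs
∈-replaceEmptyFormula {_ ∷ _} c∈ = c∈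

pos-replaceEmptyClause : ∀ c → length (pos (replaceEmptyClause c)) ≤ 1 → length (pos c) ≤ 1
pos-replaceEmptyClause ([]      ⟶ [])      _ = z≤n
pos-replaceEmptyClause ([]      ⟶ (_ ∷ _)) ≤1 = ≤1
pos-replaceEmptyClause ((_ ∷ _) ⟶ _)       ≤1 = ≤1

module Completeness (φ : Formula) (X : List Var) (X⊆letters : X ⊆ letters φ)
                    (backdoor : StrongBackdoor HORN φ X) (model : BoolModel φ) where

  open BoolModel model
  open Algorithm φ X

  ⟦_⟧ˡ : TLit → ℤ → Bool
  ⟦ l ⟧ˡ k = truth χ β k l

  θ : ℤ → Assignment X
  θ k = record { now = λ i → χ k (lookup X i) ; always = λ i → β (lookup X i) }

  value-truth : ∀ k l {b} → value (θ k) l ≡ just b → ⟦ l ⟧ˡ k ≡ b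
  value-truth k (var p) eq with p ∈ᵛ? X
  value-truth k (var p) refl | yes p∈X = cong (χ k) (Any.lookup-index p∈X)
  value-truth k (□* p) eq with p ∈ᵛ? X
  value-truth k (□* p) refl | yes p∈X = cong β (Any.lookup-index p∈X)

  var∈backdoorLits : ∀ {x} → x ∈ X → var x ∈ backdoorLits
  var∈backdoorLits x∈X = ∈-concatMap _ x∈X (here refl)

  □*∈backdoorLits : ∀ {x} → x ∈ X → □* x ∈ backdoorLits
  □*∈backdoorLits x∈X = ∈-concatMap _ x∈X (there (here refl))

  data Backdoor : TLit → Set where
    varᵇ : ∀ {x} → x ∈ X → Backdoor (var x)
    □*ᵇ  : ∀ {x} → x ∈ X → Backdoor (□* x)

  backdoorLits-⊆ : ∀ {l} → l ∈ backdoorLits → Backdoor l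
  backdoorLits-⊆ l∈ with concatMap-∈ (λ x → var x ∷ □* x ∷ []) X l∈
  ... | x , x∈X , here refl         = varᵇ x∈X
  ... | x , x∈X , there (here refl) = □*ᵇ x∈X

  value-outside : ∀ k l → l ∉ backdoorLits → value (θ k) l ≡ nothing
  value-outside k ⊥       _  = refl
  value-outside k (var p) l∉ with p ∈ᵛ? X
  ... | yes p∈X = contradiction (var∈backdoorLits p∈X) l∉
  ... | no  _   = refl
  value-outside k (□* p) l∉ with p ∈ᵛ? X
  ... | yes p∈X = contradiction (□*∈backdoorLits p∈X) l∉
  ... | no  _   = refl

  value-backdoor : ∀ k {l} → value (θ k) l ≡ just true → l ∈ backdoorLits
  value-backdoor k {l} eq with l ∈ˡ? backdoorLits
  ... | yes l∈ = l∈
  ... | no  l∉ with trans (sym eq) (value-outside k l l∉)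
  ...   | ()

  -- An unsatisfied clause is kept in the reduct, and literals outside the backdoor have no value
  -- and survive deletion; the promise bounds their number by one. The assignment is consistent by
  -- `β⇒χ`.
  unique-head : ∀ k {c l m} → c ∈ clauses φ → ¬ Satisfied (θ k) c →
                l ∈ pos c → l ∉ backdoorLits → m ∈ pos c → m ∉ backdoorLits → l ≡ m
  unique-head k {c} c∈ ¬sat l∈ l∉ m∈ m∉ = at-most-one
    (pos-replaceEmptyClause (deleteFalsified (θ k) c)
      (All.lookup (backdoor (θ k) (λ i eq → β⇒χ eq k)) (∈-replaceEmptyFormula
        (∈-map⁺ _ (∈-filter⁺ (¬? ∘ satisfied? (θ k)) c∈ ¬sat)))))
    (kept l∈ l∉) (kept m∈ m∉)
    where
    kept : ∀ {l} → l ∈ pos c → l ∉ backdoorLits → l ∈ pos (deleteFalsified (θ k) c)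
    kept {l} l∈ l∉ = ∈-filter⁺ (¬? ∘ has? (θ k) false) l∈
      λ eq → case (trans (sym eq) (value-outside k l l∉))
      where
      case : ¬ (just false ≡ nothing)
      case ()

  label : ℤ → Label
  label k = does (k ℤ.≟ 0ℤ) ∷ map (χ k) X

  True : Atom → Set
  True (⊥ , ℓ)     = Empty
  True (var p , ℓ) = ∀ k → label k ≡ ℓ → χ k p ≡ true
  True (□* p , _)  = β p ≡ true

  true-ground : ∀ k l → True (ground (label k) l) → ⟦ l ⟧ˡ k ≡ true
  true-ground k (var p) holds = holds k refl
  true-ground k (□* p)  holds = holds

  ground-true : ∀ k l → (∀ k′ → label k′ ≡ label k → ⟦ l ⟧ˡ k′ ≡ true) → True (ground (label k) l)
  ground-true k ⊥       holds with holds k refl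
  ... | ()
  ground-true k (var p) holds = holds
  ground-true k (□* p)  holds = holds k refl

  label-origin : ∀ k → origin (label k) ≡ true → k ≡ 0ℤ
  label-origin k = does-true (k ℤ.≟ 0ℤ)

  module _ {G : List Label} (occurs : ∀ {ℓ} → ℓ ∈ G → ∃[ k ] label k ≡ ℓ) (covers : ∀ k → label k ∈ G) where

    nowFact-true : ∀ {a} → a ∈ nowFacts G → True a
    nowFact-true a∈ with concatMap-∈ _ G a∈
    ... | ℓ , ℓ∈G , a∈ℓ with ∈-map⁻ _ a∈ℓ
    ...   | x , x∈ , refl = λ { k refl → [ (λ ()) , id ]′ (truths-sound (χ k) X x∈) }

    alwaysFact-true : ∀ {x a} → x ∈ X → a ∈ alwaysFact G x → True a
    alwaysFact-true {x} x∈X a∈ with all? (λ ℓ → (var x , ℓ) ∈ᵃ? nowFacts G) G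
    alwaysFact-true x∈X (here refl) | yes all =
      χ⇒β (X⊆letters x∈X) λ k → nowFact-true (All.lookup all (covers k)) k refl

    facts-true : ∀ {a} → a ∈ facts G → True a
    facts-true a∈ with ∈-++⁻ (nowFacts G) a∈
    ... | inj₁ a∈ₙ = nowFact-true a∈ₙ
    ... | inj₂ a∈ₐ = let x , x∈X , a∈x = concatMap-∈ (alwaysFact G) X a∈ₐ in alwaysFact-true x∈X a∈x

    var∈facts : ∀ {ℓ x} → ℓ ∈ G → x ∈ X → True (var x , ℓ) → (var x , ℓ) ∈ nowFacts G
    var∈facts ℓ∈G x∈X holds with occurs ℓ∈G
    ... | k , refl = ∈-concatMap _ ℓ∈G (∈-map⁺ _ (truths-complete (χ k) X x∈X (holds k refl)))

    □*∈facts : ∀ {x} → x ∈ X → β x ≡ true → (□* x , []) ∈ facts G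
    □*∈facts {x} x∈X βx = ∈-++⁺ʳ (nowFacts G) (∈-concatMap (alwaysFact G) x∈X fact)
      where
      fact : (□* x , []) ∈ alwaysFact G x
      fact with all? (λ ℓ → (var x , ℓ) ∈ᵃ? nowFacts G) G
      ... | yes _  = here refl
      ... | no ¬all = contradiction (All.tabulate λ ℓ∈G → var∈facts ℓ∈G x∈X (λ k _ → β⇒χ βx k)) ¬all

    backdoor-fact : ∀ k l → l ∈ backdoorLits → ⟦ l ⟧ˡ k ≡ true → ground (label k) l ∈ facts G
    backdoor-fact k l l∈ holds with backdoorLits-⊆ l∈
    ... | varᵇ x∈X = ∈-++⁺ˡ (∈-concatMap _ (covers k) (∈-map⁺ _ (truths-complete (χ k) X x∈X holds)))
    ... | □*ᵇ x∈X  = □*∈facts x∈X holds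

    -- Carrying `facts G` along turns absence into information: a backdoor atom missing from `D`, at
    -- a label of `G`, is not true in the model.
    Sound : List Atom → Set
    Sound D = facts G ⊆ D × All True D

    -- For rules with one conclusion: a true conclusion in the backdoor would be a fact, hence
    -- already in `D`, so falsum is not what gets derived.
    firstOutside-sound : ∀ {a D} → Sound D → True a → (proj₁ a ∈ backdoorLits → a ∈ facts G) →
                         ¬ Any (_∈ D) (a ∷ []) → True (firstOutside (a ∷ []))
    firstOutside-sound {a} (facts⊆D , _) holds fact a∉D with proj₁ a ∈ˡ? backdoorLits
    ... | yes a∈B = contradiction (here (facts⊆D (fact a∈B))) a∉D
    ... | no  _   = holds

    -- The premises are true, so a positive literal satisfies the clause at `k`. Inside the backdoor
    -- it would be a fact and a conclusion would be present, so it lies outside. For the same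
    -- reasons `θ k` does not satisfy the clause, and `unique-head` applies.
    clause-sound : ∀ k {c D} → c ∈ clauses φ → Sound D → Fireable D (clauseRule (label k) c) →
                   ¬ Any (_∈ D) (conclusions (clauseRule (label k) c)) →
                   ∃[ l ] (l ∈ pos c × l ∉ backdoorLits × ⟦ l ⟧ˡ k ≡ true
                         × (∀ {m} → m ∈ pos c → m ∉ backdoorLits → l ≡ m))
    clause-sound k {c} {D} c∈ (facts⊆D , D-true) fireable ¬concl with holds k c∈
    ... | inj₁ fails with find fails
    ...   | l , l∈ , ⟦l⟧ = contradiction (trans (sym ⟦l⟧) (premise-true l∈)) λ ()
      where
      premise-true : ∀ {l} → l ∈ neg c → ⟦ l ⟧ˡ k ≡ true
      premise-true {l} l∈ = true-ground k l (All.lookup D-true (All.lookup fireable (∈-map⁺ _ l∈)))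
    clause-sound k {c} {D} c∈ (facts⊆D , D-true) fireable ¬concl | inj₂ some with find some
    ... | l , l∈ , ⟦l⟧ = l , l∈ , outside l∈ ⟦l⟧ , ⟦l⟧ , λ m∈ m∉ → unique-head k c∈ ¬sat l∈ (outside l∈ ⟦l⟧) m∈ m∉
      where
      outside : ∀ {l} → l ∈ pos c → ⟦ l ⟧ˡ k ≡ true → l ∉ backdoorLits
      outside {l} l∈ ⟦l⟧ l∈B = ¬concl (lose (∈-map⁺ _ l∈) (facts⊆D (backdoor-fact k l l∈B ⟦l⟧)))
      ¬sat : ¬ Satisfied (θ k) c
      ¬sat (inj₁ has) with find has
      ... | l , l∈ , eq with trans (sym (value-truth k l eq))
                                   (true-ground k l (All.lookup D-true (All.lookup fireable (∈-map⁺ _ l∈))))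
      ...   | ()
      ¬sat (inj₂ has) with find has
      ... | l , l∈ , eq = outside l∈ (value-truth k l eq) (value-backdoor k eq)

    rule-sound : ∀ {r D} → RuleOf G r → Sound D → Fireable D r → ¬ Any (_∈ D) (conclusions r) →
                 True (firstOutside (conclusions r))
    rule-sound (initialʳ {ℓ} {p} ℓ∈G ℓ-origin p∈) sound _ =
      firstOutside-sound sound initially-true λ l∈ → ∈-++⁺ˡ (fact (backdoorLits-⊆ l∈))
      where
      initially-true : True (var p , ℓ)
      initially-true k refl with label-origin k ℓ-origin
      ... | refl = initially p∈
      fact : Backdoor (var p) → (var p , ℓ) ∈ nowFacts G
      fact (varᵇ p∈X) = var∈facts ℓ∈G p∈X initially-true
    rule-sound (elimʳ {ℓ} {p} ℓ∈G p∈) sound@(_ , D-true) (□p∈D ∷ []) =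
      firstOutside-sound sound now-true′ λ l∈ → ∈-++⁺ˡ (fact (backdoorLits-⊆ l∈))
      where
      now-true′ : True (var p , ℓ)
      now-true′ k _ = β⇒χ (All.lookup D-true □p∈D) k
      fact : Backdoor (var p) → (var p , ℓ) ∈ nowFacts G
      fact (varᵇ p∈X) = var∈facts ℓ∈G p∈X now-true′
    rule-sound (introʳ {p} p∈) sound@(_ , D-true) fireable =
      firstOutside-sound sound always-true′ λ l∈ → fact (backdoorLits-⊆ l∈)
      where
      always-true′ : β p ≡ true
      always-true′ = χ⇒β p∈ λ k → All.lookup D-true (All.lookup fireable (∈-map⁺ _ (covers k))) k refl
      fact : Backdoor (□* p) → (□* p , []) ∈ facts G
      fact (□*ᵇ p∈X) = □*∈facts p∈X always-true′
    rule-sound {D = D} (clauseʳ {ℓ} {c} ℓ∈G c∈) sound fireable ¬concl with occurs ℓ∈G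
    ... | k , refl with firstOutside-spec (map (ground (label k)) (pos c))
    -- Falsum cannot be derived: the true literal found by `clause-sound` lies outside the backdoor.
    ...   | inj₁ (inside , eq) = contradiction
              (subst (_∈ backdoorLits) (proj₁-ground (label k) _) (All.lookup inside (∈-map⁺ _ l∈))) l∉
      where
      witness = clause-sound k c∈ sound fireable ¬concl
      l∈ = proj₁ (proj₂ witness)
      l∉ = proj₁ (proj₂ (proj₂ witness))
    ...   | inj₂ (∈H , ∉B) with ∈-map⁻ (ground (label k)) ∈H
    ...     | m , m∈ , eq = subst True (sym eq) (ground-true k m everywhere)
      where
      m∉ : m ∉ backdoorLits
      m∉ = ∉B ∘ subst (_∈ backdoorLits) (sym (trans (cong proj₁ eq) (proj₁-ground (label k) m)))
      everywhere : ∀ k′ → label k′ ≡ label k → ⟦ m ⟧ˡ k′ ≡ true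
      -- Each moment with this label has its own true literal, possibly a different one a priori;
      -- uniqueness identifies it with `m`.
      everywhere k′ same with clause-sound k′ c∈ sound
        (subst (λ ℓ → Fireable D (clauseRule ℓ c)) (sym same) fireable)
        (subst (λ ℓ → ¬ Any (_∈ D) (conclusions (clauseRule ℓ c))) (sym same) ¬concl)
      ... | l , _ , _ , ⟦l⟧ , unique = subst (λ l → ⟦ l ⟧ˡ k′ ≡ true) (unique m∈ m∉) ⟦l⟧

    closure-sound : Sound (closure G)
    closure-sound = saturate-preserves Sound
      (λ r∈ sound@(facts⊆D , D-true) fireable ¬concl →
        there ∘ facts⊆D , rule-sound (rule-of r∈) sound fireable ¬concl ∷ D-true)
      (rules G) (rules G) (facts G) id (id , All.tabulate facts-true)

    accepted : Accepts G
    accepted = lose (covers 0ℤ) refl , λ falsum → absurd (find falsum)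
      where
      absurd : ¬ (∃[ a ] (a ∈ closure G × proj₁ a ≡ ⊥))
      absurd ((⊥ , _) , a∈ , refl) = All.lookup (proj₂ closure-sound) a∈

  some-accepted : ¬ ¬ Any Accepts (guesses (suc (length X)))
  some-accepted ¬any = guess-exists (suc (length X)) (λ ℓ → ∃[ k ] label k ≡ ℓ)
    λ (G , G∈ , occurs , covers) →
      ¬any (lose G∈ (accepted occurs λ k → covers (cong suc (length-map (χ k) X)) (k , refl)))

module _ (φ : Formula) (X : List Var) where

  open Algorithm φ X

  satisfiable? : Dec (Any Accepts (guesses (suc (length X))))
  satisfiable? = any? accepts? (guesses (suc (length X)))

  accepted-satisfiable : Any Accepts (guesses (suc (length X))) → Satisfiable φ
  accepted-satisfiable accepted = let G , _ , acc = find accepted in Soundness.accepts-sound φ X G acc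

  satisfiable-accepted : X ⊆ letters φ → StrongBackdoor HORN φ X → Satisfiable φ →
                         Any Accepts (guesses (suc (length X)))
  satisfiable-accepted X⊆ backdoor sat = decidable-stable satisfiable? λ ¬accepted →
    ¬¬□? (letters φ) λ □? →
      Completeness.some-accepted φ X X⊆ backdoor (boolModel (proj₂ sat) □?) ¬accepted
    where
    -- Double negation commutes with finite conjunctions, so all letters can be decided at once; the
    -- moments, being infinitely many, are handled by `Now` instead.
    ¬¬□? : ∀ ps → ¬ ¬ All (λ p → Dec (∀ k → proj₁ sat p k)) ps
    ¬¬□? []       ¬all = ¬all []
    ¬¬□? (p ∷ ps) ¬all = ¬¬-excluded-middle λ d → ¬¬□? ps λ ds → ¬all (d ∷ ds)

-- The algorithm on encoded data

ifT-encode : ∀ (e : A → Tree) b {x y} → ifT (encodeBool b) (e x) (e y) ≡ e (ifᵇ b then x else y)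
ifT-encode e true  = refl
ifT-encode e false = refl

module _ {e : A → Tree} {s : Tree → Tree} where

  mapT-encode : ∀ {e′ : A′ → Tree} {f} → (∀ x → s (e x) ≡ e′ (f x)) →
                ∀ xs → mapT s (encodeList e xs) ≡ encodeList e′ (map f xs)
  mapT-encode s≗f []       = refl
  mapT-encode s≗f (x ∷ xs) = cong₂ cons (s≗f x) (mapT-encode s≗f xs)

  anyT-encode : ∀ {P : A → Set} (P? : Decidable P) → (∀ x → s (e x) ≡ encodeBool (does (P? x))) →
                ∀ xs → anyT s (encodeList e xs) ≡ encodeBool (does (any? P? xs))
  anyT-encode P? s≗P []       = refl
  anyT-encode P? s≗P (x ∷ xs) rewrite s≗P x with does (P? x)
  ... | true  = refl
  ... | false = anyT-encode P? s≗P xs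

  allT-encode : ∀ {P : A → Set} (P? : Decidable P) → (∀ x → s (e x) ≡ encodeBool (does (P? x))) →
                ∀ xs → allT s (encodeList e xs) ≡ encodeBool (does (all? P? xs))
  allT-encode P? s≗P []       = refl
  allT-encode P? s≗P (x ∷ xs) rewrite s≗P x with does (P? x)
  ... | true  = allT-encode P? s≗P xs
  ... | false = refl

appendT-encode : ∀ (e : A → Tree) xs ys →
                 appendT (encodeList e xs) (encodeList e ys) ≡ encodeList e (xs ++ ys)
appendT-encode e []       ys = refl
appendT-encode e (x ∷ xs) ys = cong (cons (e x)) (appendT-encode e xs ys)

concatMapT-encode : ∀ {e : A → Tree} {e′ : A′ → Tree} {s f} → (∀ x → s (e x) ≡ encodeList e′ (f x)) →
                    ∀ xs → concatMapT s (encodeList e xs) ≡ encodeList e′ (concatMap f xs)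
concatMapT-encode s≗f []       = refl
concatMapT-encode {e = e} {e′} {s} {f} s≗f (x ∷ xs) =
  trans (cong₂ appendT (s≗f x) (concatMapT-encode {e = e} {s = s} s≗f xs)) (appendT-encode e′ (f x) (concatMap f xs))

notT-encode : ∀ b → notT (encodeBool b) ≡ encodeBool (not b)
notT-encode true  = refl
notT-encode false = refl

andT-encode : ∀ a b → andT (encodeBool a) (encodeBool b) ≡ encodeBool (a ∧ b)
andT-encode true  b = refl
andT-encode false b = refl

-- Growth bounds must hold for malformed states too. Reading a state through `hd` and `tl` covers
-- `nil` as well, and `weight` differs from `size` by at most 1.
weight : Tree → ℕ
weight s = size (hd s) + size (tl s)

weight≤ : ∀ s → weight s ≤ 1 + size s
weight≤ nil        = ≤-refl
weight≤ (cons s t) = ≤-trans (n≤1+n _) (n≤1+n _)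

size≤ : ∀ s → size s ≤ 1 + weight s
size≤ nil        = s≤s z≤n
size≤ (cons s t) = ≤-refl

sameBitT : Tree → Tree → Tree
sameBitT a b = ifT a b (notT b)

-- The state is  cons nil ys  when ys is what remains to be matched, and nil
-- after a mismatch.

matchT : Tree → Tree → Tree
matchT x s = ifT s (ifT (tl s) (ifT (sameBitT x (hd (tl s))) (cons nil (tl (tl s))) nil) nil) nil

matchedT : Tree → Tree
matchedT s = ifT s (notT (tl s)) nil

eqBitsT : Tree → Tree → Tree
eqBitsT xs ys = matchedT (foldlT matchT (cons nil ys) xs)

eqBitsᴾ : PolyTime f → PolyTime g → PolyTime (λ d → eqBitsT (f d) (g d))
eqBitsᴾ F G = ifᴾ idᴾ (notᴾ (tlᴾ idᴾ)) nilᴾ ∘ᴾ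
  foldlᴾ (ifᴾ v₁ (ifᴾ (tlᴾ v₁) (ifᴾ (ifᴾ v₀ (hdᴾ (tlᴾ v₁)) (notᴾ (hdᴾ (tlᴾ v₁))))
                                    (consᴾ nilᴾ (tlᴾ (tlᴾ v₁))) nilᴾ) nilᴾ) nilᴾ)
         (con 2) (λ x s env → growth x s) (consᴾ nilᴾ G) F
  where
  growth : ∀ x s → size (matchT x s) ≤ size s + 2
  growth x s = size-ifT s (size-ifT (tl s) (size-ifT (sameBitT x (hd (tl s))) matched 1≤) 1≤) 1≤
    where
    1≤ : 1 ≤ size s + 2
    1≤ = ≤-trans (1≤size s) (m≤m+n (size s) 2)
    matched : size (cons nil (tl (tl s))) ≤ size s + 2
    matched = ≤-trans (+-monoʳ-≤ 2 (≤-trans (size-tl (tl s)) (size-tl s))) (≤-reflexive (+-comm 2 (size s)))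

eqBitsT-encode : ∀ xs ys → eqBitsT (encodeVar xs) (encodeVar ys) ≡ encodeBool (does (xs ≟ᵛ ys))
eqBitsT-encode []           []           = refl
eqBitsT-encode []           (y ∷ ys)     = refl
eqBitsT-encode (x ∷ xs)     ys₀          with mismatch xs
  where
  mismatch : ∀ xs → foldlT matchT nil (encodeVar xs) ≡ nil
  mismatch []       = refl
  mismatch (x ∷ xs) = mismatch xs
eqBitsT-encode (x ∷ xs)     []           | eq = cong matchedT eq
eqBitsT-encode (true  ∷ xs) (false ∷ ys) | eq = cong matchedT eq
eqBitsT-encode (false ∷ xs) (true  ∷ ys) | eq = cong matchedT eq
eqBitsT-encode (true  ∷ xs) (true  ∷ ys) | eq = eqBitsT-encode xs ys
eqBitsT-encode (false ∷ xs) (false ∷ ys) | eq = eqBitsT-encode xs ys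

encodeTLit-litBits : ∀ l → encodeTLit l ≡ encodeVar (litBits l)
encodeTLit-litBits ⊥       = refl
encodeTLit-litBits (var p) = refl
encodeTLit-litBits (□* p)  = refl

eqLitT-encode : ∀ l m → eqBitsT (encodeTLit l) (encodeTLit m) ≡ encodeBool (does (l ≟ˡ m))
eqLitT-encode l m rewrite encodeTLit-litBits l | encodeTLit-litBits m = eqBitsT-encode (litBits l) (litBits m)

encodeAtom : Atom → Tree
encodeAtom (l , ℓ) = cons (encodeTLit l) (encodeVar ℓ)

encodeAtoms : List Atom → Tree
encodeAtoms = encodeList encodeAtom

encodeRule : Rule → Tree
encodeRule r = cons (encodeAtoms (premises r)) (encodeAtoms (conclusions r))

eqAtomT : Tree → Tree → Tree
eqAtomT a b = andT (eqBitsT (hd a) (hd b)) (eqBitsT (tl a) (tl b))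

eqAtomᴾ : PolyTime f → PolyTime g → PolyTime (λ d → eqAtomT (f d) (g d))
eqAtomᴾ F G = andᴾ (eqBitsᴾ (hdᴾ F) (hdᴾ G)) (eqBitsᴾ (tlᴾ F) (tlᴾ G))

eqAtomT-encode : ∀ a b → eqAtomT (encodeAtom a) (encodeAtom b) ≡ encodeBool (does (a ≟ᵃ b))
eqAtomT-encode (l , ℓ) (m , k) = trans (cong₂ andT (eqLitT-encode l m) (eqBitsT-encode ℓ k))
                                       (andT-encode (does (l ≟ˡ m)) (does (ℓ ≟ᵛ k)))

memberT : Tree → Tree → Tree
memberT a D = anyT (eqAtomT a) D

memberᴾ : PolyTime f → PolyTime g → PolyTime (λ d → memberT (f d) (g d))
memberᴾ F G = anyᴾ (eqAtomᴾ (weaken F) v₀) G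

memberT-encode : ∀ D a → memberT (encodeAtom a) (encodeAtoms D) ≡ encodeBool (does (a ∈ᵃ? D))
memberT-encode D a = anyT-encode (a ≟ᵃ_) (eqAtomT-encode a) D

-- Among encoded literals only boxed variables have a head other than `nil`, so one test separates
-- them from `⊥` and `var`.
groundT : Tree → Tree → Tree
groundT ℓ l = ifT (hd l) (cons l nil) (cons l ℓ)

groundᴾ : PolyTime f → PolyTime g → PolyTime (λ d → groundT (f d) (g d))
groundᴾ F G = ifᴾ (hdᴾ G) (consᴾ G nilᴾ) (consᴾ G F)

groundT-encode : ∀ ℓ l → groundT (encodeVar ℓ) (encodeTLit l) ≡ encodeAtom (ground ℓ l)
groundT-encode ℓ ⊥       = refl
groundT-encode ℓ (var p) = refl
groundT-encode ℓ (□* p)  = refl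

falsumT : Tree
falsumT = cons nil nil

firstOutsideT : Tree → Tree → Tree
firstOutsideT B H = foldrT (λ h acc → ifT (anyT (eqBitsT (hd h)) B) acc h) falsumT H

firstOutsideᴾ : PolyTime f → PolyTime g → PolyTime (λ d → firstOutsideT (f d) (g d))
firstOutsideᴾ {f} F G = foldrᴾ
  (ifᴾ (anyᴾ (eqBitsᴾ (hdᴾ (hdᴾ (tlᴾ idᴾ))) v₀) (F ∘ᴾ tlᴾ (tlᴾ idᴾ))) v₁ v₀) 𝕏
  (λ x acc env → size-ifT (anyT (eqBitsT (hd x)) (f env)) (m≤m+n (size acc) _)
                   (≤-trans (m≤m+n (size x) (size env)) (m≤n+m _ (size acc))))
  (constᴾ falsumT) G

deriveT : Tree → Tree → Tree → Tree
deriveT B H D = ifT (anyT (λ a → memberT a D) H) D (cons (firstOutsideT B H) D)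

deriveᴾ : PolyTime f → PolyTime g → PolyTime h → PolyTime (λ d → deriveT (f d) (g d) (h d))
deriveᴾ F G H = ifᴾ (anyᴾ (memberᴾ v₀ (weaken H)) G) H (consᴾ (firstOutsideᴾ F G) H)

-- Not firing nil, which encodes no rule, makes every step trade a rule for an
-- atom that is no larger.

fireT : Tree → Tree → Tree → Tree
fireT B r s = ifT (andT r (allT (λ a → memberT a (tl s)) (hd r)))
                  (cons (hd s) (deriveT B (tl r) (tl s)))
                  (cons (cons r (hd s)) (tl s))

fireᴾ : PolyTime f → PolyTime g → PolyTime h → PolyTime (λ d → fireT (f d) (g d) (h d))
fireᴾ F G H = ifᴾ (andᴾ G (allᴾ (memberᴾ v₀ (weaken (tlᴾ H))) (hdᴾ G)))
                  (consᴾ (hdᴾ H) (deriveᴾ F (tlᴾ G) (tlᴾ H)))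
                  (consᴾ (consᴾ G (hdᴾ H)) (tlᴾ H))

ifT-elim : ∀ (P : Tree → Set) c {a b} → P a → P b → P (ifT c a b)
ifT-elim P nil        Pa Pb = Pb
ifT-elim P (cons _ _) Pa Pb = Pa

size-firstOutsideT : ∀ B H {n} → 3 ≤ n → size H ≤ n → size (firstOutsideT B H) ≤ n
size-firstOutsideT B nil        3≤n H≤n = 3≤n
size-firstOutsideT B (cons h H) 3≤n H≤n = size-ifT (anyT (eqBitsT (hd h)) B)
  (size-firstOutsideT B H 3≤n (≤-trans (size-tl (cons h H)) H≤n)) (≤-trans (size-hd (cons h H)) H≤n)

weight-fireT : ∀ B r s → weight (fireT B r s) ≤ 1 + size r + weight s
weight-fireT B nil          s = ≤-refl
weight-fireT B r@(cons b c) s = ifT-elim (λ t → weight t ≤ 1 + size r + weight s)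
  (allT (λ a → memberT a (tl s)) b) fired (≤-reflexive (+-assoc (1 + size r) (size (hd s)) (size (tl s))))
  where
  -- The derived atom may be `falsumT`, of size 3; a rule that fires is a `cons` and is large enough
  -- to pay for it.
  3≤r : 3 ≤ size r
  3≤r = s≤s (+-mono-≤ (1≤size b) (1≤size c))
  derived : size (deriveT B c (tl s)) ≤ 1 + size r + size (tl s)
  derived = size-ifT (anyT (λ a → memberT a (tl s)) c) (m≤n+m (size (tl s)) (1 + size r))
    (s≤s (+-monoˡ-≤ (size (tl s)) (size-firstOutsideT B c 3≤r (size-tl r))))
  fired : size (hd s) + size (deriveT B c (tl s)) ≤ 1 + size r + weight s
  fired = begin
    size (hd s) + size (deriveT B c (tl s))     ≤⟨ +-monoʳ-≤ (size (hd s)) derived ⟩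
    size (hd s) + (1 + size r + size (tl s))    ≡⟨ +-assoc (size (hd s)) (1 + size r) _ ⟨
    size (hd s) + (1 + size r) + size (tl s)    ≡⟨ cong (_+ size (tl s)) (+-comm (size (hd s)) (1 + size r)) ⟩
    1 + size r + size (hd s) + size (tl s)      ≡⟨ +-assoc (1 + size r) (size (hd s)) _ ⟩
    1 + size r + weight s                       ∎
    where open ≤-Reasoning

passT : Tree → Tree → Tree → Tree
passT B rs D = foldrT (fireT B) (cons nil D) rs

-- Rules and atoms together do not grow during a pass. This is why saturation, a loop of passes,
-- still has additive growth: the constant 2 only converts between `weight` and `size`.
weight-passT : ∀ B rs D → weight (passT B rs D) ≤ size rs + size D
weight-passT B nil         D = ≤-refl
weight-passT B (cons r rs) D = begin
  weight (fireT B r (passT B rs D))             ≤⟨ weight-fireT B r (passT B rs D) ⟩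
  1 + size r + weight (passT B rs D)            ≤⟨ +-monoʳ-≤ (1 + size r) (weight-passT B rs D) ⟩
  1 + size r + (size rs + size D)               ≡⟨ +-assoc (1 + size r) (size rs) (size D) ⟨
  size (cons r rs) + size D                     ∎
  where open ≤-Reasoning

passᴾ : PolyTime f → PolyTime g → PolyTime h → PolyTime (λ d → passT (f d) (g d) (h d))
passᴾ {f} F G H = foldrᴾ (fireᴾ (F ∘ᴾ tlᴾ (tlᴾ idᴾ)) v₀ v₁) (con 3 ⊕ 𝕏)
  (λ x s env → growth (f env) x s env) (consᴾ nilᴾ H) G
  where
  growth : ∀ B r s env → size (fireT B r s) ≤ size s + (3 + (size r + size env))
  growth B r s env = begin
    size (fireT B r s)                   ≤⟨ size≤ (fireT B r s) ⟩
    1 + weight (fireT B r s)             ≤⟨ s≤s (weight-fireT B r s) ⟩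
    2 + size r + weight s                ≤⟨ +-monoʳ-≤ (2 + size r) (weight≤ s) ⟩
    2 + size r + (1 + size s)            ≡⟨ +-suc (2 + size r) (size s) ⟩
    3 + size r + size s                  ≤⟨ +-monoˡ-≤ (size s) (+-monoʳ-≤ 3 (m≤m+n (size r) (size env))) ⟩
    3 + (size r + size env) + size s     ≡⟨ +-comm (3 + (size r + size env)) (size s) ⟩
    size s + (3 + (size r + size env))   ∎
    where open ≤-Reasoning

saturateT : Tree → Tree → Tree → Tree
saturateT B fuel s = foldlT (λ _ s → passT B (hd s) (tl s)) s fuel

saturateᴾ : PolyTime f → PolyTime g → PolyTime h → PolyTime (λ d → saturateT (f d) (g d) (h d))
saturateᴾ {f} F G H = foldlᴾ (passᴾ (F ∘ᴾ tlᴾ (tlᴾ idᴾ)) (hdᴾ v₁) (tlᴾ v₁)) (con 2)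
  (λ x s env → growth (f env) s) H G
  where
  growth : ∀ B s → size (passT B (hd s) (tl s)) ≤ size s + 2
  growth B s = begin
    size (passT B (hd s) (tl s))         ≤⟨ size≤ (passT B (hd s) (tl s)) ⟩
    1 + weight (passT B (hd s) (tl s))   ≤⟨ s≤s (weight-passT B (hd s) (tl s)) ⟩
    1 + weight s                         ≤⟨ s≤s (weight≤ s) ⟩
    2 + size s                           ≡⟨ +-comm 2 (size s) ⟩
    size s + 2                           ∎
    where open ≤-Reasoning

module _ (B : List TLit) where

  open Saturation B

  private
    BT : Tree
    BT = encodeList encodeTLit B

    encodeState : List Rule × List Atom → Tree
    encodeState (rs , D) = cons (encodeList encodeRule rs) (encodeAtoms D)

  firstOutsideT-encode : ∀ H → firstOutsideT BT (encodeAtoms H) ≡ encodeAtom (firstOutside H)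
  firstOutsideT-encode []            = refl
  firstOutsideT-encode ((l , ℓ) ∷ H) = trans
    (cong₂ (λ c acc → ifT c acc (encodeAtom (l , ℓ)))
           (anyT-encode (l ≟ˡ_) (eqLitT-encode l) B) (firstOutsideT-encode H))
    (ifT-encode encodeAtom (does (l ∈ˡ? B)))

  deriveT-encode : ∀ H D → deriveT BT (encodeAtoms H) (encodeAtoms D) ≡ encodeAtoms (derive H D)
  deriveT-encode H D = trans
    (cong₂ (λ c a → ifT c (encodeAtoms D) (cons a (encodeAtoms D)))
           (anyT-encode (_∈ᵃ? D) (memberT-encode D) H) (firstOutsideT-encode H))
    (ifT-encode encodeAtoms (does (any? (_∈ᵃ? D) H)))

  fireT-encode : ∀ r s → fireT BT (encodeRule r) (encodeState s) ≡ encodeState (fire r s)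
  fireT-encode r (rs , D) = trans
    (cong₂ (λ c D′ → ifT c (cons (encodeList encodeRule rs) D′) (encodeState (r ∷ rs , D)))
           (allT-encode (_∈ᵃ? D) (memberT-encode D) (premises r)) (deriveT-encode (conclusions r) D))
    (ifT-encode encodeState (does (all? (_∈ᵃ? D) (premises r))))

  passT-encode : ∀ rs D → passT BT (encodeList encodeRule rs) (encodeAtoms D) ≡ encodeState (pass rs D)
  passT-encode []       D = refl
  passT-encode (r ∷ rs) D = trans (cong (fireT BT (encodeRule r)) (passT-encode rs D)) (fireT-encode r (pass rs D))

  saturateT-encode : ∀ fuel s →
    saturateT BT (encodeList encodeRule fuel) (encodeState s) ≡ encodeState (saturate fuel s)
  saturateT-encode []         s        = refl
  saturateT-encode (_ ∷ fuel) (rs , D) =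
    trans (cong (λ s → saturateT BT (encodeList encodeRule fuel) s) (passT-encode rs D))
          (saturateT-encode fuel (pass rs D))

-- The state consists of the remaining bits and the variables collected so far.

collectT : Tree → Tree → Tree
collectT x s = cons (tl (hd s)) (ifT (hd (hd s)) (cons x (tl s)) (tl s))

truthsT : Tree → Tree → Tree
truthsT X t = tl (foldlT collectT (cons t nil) X)

truthsᴾ : PolyTime f → PolyTime g → PolyTime (λ d → truthsT (f d) (g d))
truthsᴾ F G = tlᴾ (foldlᴾ
  (consᴾ (tlᴾ (hdᴾ v₁)) (ifᴾ (hdᴾ (hdᴾ v₁)) (consᴾ v₀ (tlᴾ v₁)) (tlᴾ v₁)))
  (con 3 ⊕ 𝕏) (λ x s env → growth x s env) (consᴾ G nilᴾ) F)
  where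
  growth : ∀ x s env → size (collectT x s) ≤ size s + (3 + (size x + size env))
  growth x s env = begin
    1 + (size (tl (hd s)) + size (ifT (hd (hd s)) (cons x (tl s)) (tl s)))
      ≤⟨ s≤s (+-mono-≤ (size-tl (hd s)) (size-ifT (hd (hd s)) ≤-refl (m≤n+m (size (tl s)) (1 + size x)))) ⟩
    1 + (size (hd s) + (1 + size x + size (tl s)))
      ≡⟨ arrange (size (hd s)) (size x) (size (tl s)) ⟩
    weight s + (2 + size x)
      ≤⟨ +-monoˡ-≤ (2 + size x) (weight≤ s) ⟩
    1 + size s + (2 + size x)
      ≡⟨ +-suc (size s) (2 + size x) ⟨
    size s + (3 + size x)
      ≤⟨ +-monoʳ-≤ (size s) (+-monoʳ-≤ 3 (m≤m+n (size x) (size env))) ⟩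
    size s + (3 + (size x + size env)) ∎
    where
    open ≤-Reasoning
    arrange : ∀ a x b → 1 + (a + (1 + x + b)) ≡ a + b + (2 + x)
    arrange = solve-∀

truthsT-encode : ∀ X t → truthsT (encodeList encodeVar X) (encodeVar t) ≡ encodeList encodeVar (truths X t [])
truthsT-encode X t = go X t []
  where
  go : ∀ X t acc →
       tl (foldlT collectT (cons (encodeVar t) (encodeList encodeVar acc)) (encodeList encodeVar X))
       ≡ encodeList encodeVar (truths X t acc)
  go []      t           acc = refl
  go (x ∷ X) []          acc = go X [] acc
  go (x ∷ X) (true  ∷ t) acc = go X t (x ∷ acc)
  go (x ∷ X) (false ∷ t) acc = go X t acc

-- Rules, facts and acceptance as tree programs

varT □*T : Tree → Tree
varT p = cons nil p
□*T p  = cons trueT p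

varᴾ : PolyTime f → PolyTime (λ d → varT (f d))
varᴾ F = consᴾ nilᴾ F

□*ᴾ : PolyTime f → PolyTime (λ d → □*T (f d))
□*ᴾ F = consᴾ trueᴾ F

singletonT : Tree → Tree
singletonT a = cons a nil

singletonᴾ : PolyTime f → PolyTime (λ d → singletonT (f d))
singletonᴾ F = consᴾ F nilᴾ

lettersOfT : Tree → Tree
lettersOfT c = appendT (mapT tl (hd c)) (mapT tl (tl c))

lettersT : Tree → Tree
lettersT C = concatMapT lettersOfT C

lettersᴾ : PolyTime f → PolyTime (λ d → lettersT (f d))
lettersᴾ F = concatMapᴾ (appendᴾ (mapᴾ (tlᴾ v₀) (hdᴾ v₀)) (mapᴾ (tlᴾ v₀) (tlᴾ v₀))) F

lettersT-encode : ∀ φ → lettersT (encodeList encodeClause (clauses φ)) ≡ encodeList encodeVar (letters φ)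
lettersT-encode φ = concatMapT-encode {s = lettersOfT} (λ c → trans
  (cong₂ appendT (mapT-encode {s = tl} litVar-encode (neg c)) (mapT-encode {s = tl} litVar-encode (pos c)))
  (appendT-encode encodeVar (map litVar (neg c)) (map litVar (pos c)))) (clauses φ)
  where
  litVar-encode : ∀ l → tl (encodeTLit l) ≡ encodeVar (litVar l)
  litVar-encode ⊥       = refl
  litVar-encode (var p) = refl
  litVar-encode (□* p)  = refl

clauseRuleT : Tree → Tree → Tree
clauseRuleT ℓ c = cons (mapT (groundT ℓ) (hd c)) (mapT (groundT ℓ) (tl c))

initialRuleT : Tree → Tree → Tree
initialRuleT ℓ p = cons nil (singletonT (cons (varT p) ℓ))

□-elimT : Tree → Tree → Tree
□-elimT ℓ p = cons (singletonT (cons (□*T p) nil)) (singletonT (cons (varT p) ℓ))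

□-introT : Tree → Tree → Tree
□-introT G p = cons (mapT (λ ℓ → cons (varT p) ℓ) G) (singletonT (cons (□*T p) nil))

rulesAtT : Tree → Tree → Tree → Tree → Tree
rulesAtT I C L ℓ = appendT (ifT (hd ℓ) (mapT (initialRuleT ℓ) I) nil)
                           (appendT (mapT (clauseRuleT ℓ) C) (mapT (□-elimT ℓ) L))

rulesT : Tree → Tree → Tree → Tree → Tree
rulesT I C L G = appendT (concatMapT (rulesAtT I C L) G) (mapT (□-introT G) L)

clauseRuleᴾ : PolyTime f → PolyTime g → PolyTime (λ d → clauseRuleT (f d) (g d))
clauseRuleᴾ F G = consᴾ (mapᴾ (groundᴾ (weaken F) v₀) (hdᴾ G)) (mapᴾ (groundᴾ (weaken F) v₀) (tlᴾ G))

rulesAtᴾ : PolyTime f → PolyTime g → PolyTime h → PolyTime i →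
           PolyTime (λ d → rulesAtT (f d) (g d) (h d) (i d))
rulesAtᴾ I C L ℓ = appendᴾ
  (ifᴾ (hdᴾ ℓ) (mapᴾ (consᴾ nilᴾ (singletonᴾ (consᴾ (varᴾ v₀) (weaken ℓ)))) I) nilᴾ)
  (appendᴾ (mapᴾ (clauseRuleᴾ (weaken ℓ) v₀) C)
           (mapᴾ (consᴾ (singletonᴾ (consᴾ (□*ᴾ v₀) nilᴾ)) (singletonᴾ (consᴾ (varᴾ v₀) (weaken ℓ)))) L))

rulesᴾ : PolyTime f → PolyTime g → PolyTime h → PolyTime i →
         PolyTime (λ d → rulesT (f d) (g d) (h d) (i d))
rulesᴾ I C L G = appendᴾ
  (concatMapᴾ (rulesAtᴾ (weaken I) (weaken C) (weaken L) v₀) G)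
  (mapᴾ (consᴾ (mapᴾ (consᴾ (varᴾ (weaken v₀)) v₀) (weaken G)) (singletonᴾ (consᴾ (□*ᴾ v₀) nilᴾ))) L)

nowFactsAtT : Tree → Tree → Tree
nowFactsAtT X ℓ = mapT (λ x → cons (varT x) ℓ) (truthsT X (tl ℓ))

nowFactsT : Tree → Tree → Tree
nowFactsT X G = concatMapT (nowFactsAtT X) G

nowFactsᴾ : PolyTime f → PolyTime g → PolyTime (λ d → nowFactsT (f d) (g d))
nowFactsᴾ X G = concatMapᴾ (mapᴾ (consᴾ (varᴾ v₀) (weaken v₀)) (truthsᴾ (weaken X) (tlᴾ v₀))) G

alwaysFactT : Tree → Tree → Tree → Tree
alwaysFactT N G x = ifT (allT (λ ℓ → memberT (cons (varT x) ℓ) N) G) (singletonT (cons (□*T x) nil)) nil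

alwaysFactᴾ : PolyTime f → PolyTime g → PolyTime h → PolyTime (λ d → alwaysFactT (f d) (g d) (h d))
alwaysFactᴾ N G x = ifᴾ (allᴾ (memberᴾ (consᴾ (varᴾ (weaken x)) v₀) (weaken N)) G)
                        (singletonᴾ (consᴾ (□*ᴾ x) nilᴾ)) nilᴾ

factsT : Tree → Tree → Tree
factsT X G = appendT (nowFactsT X G) (concatMapT (alwaysFactT (nowFactsT X G) G) X)

factsᴾ : PolyTime f → PolyTime g → PolyTime (λ d → factsT (f d) (g d))
factsᴾ X G = appendᴾ (nowFactsᴾ X G)
  (concatMapᴾ (alwaysFactᴾ (weaken (nowFactsᴾ X G)) (weaken G) v₀) X)

backdoorLitsT : Tree → Tree
backdoorLitsT X = concatMapT (λ x → cons (varT x) (singletonT (□*T x))) X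

backdoorLitsᴾ : PolyTime f → PolyTime (λ d → backdoorLitsT (f d))
backdoorLitsᴾ X = concatMapᴾ (consᴾ (varᴾ v₀) (singletonᴾ (□*ᴾ v₀))) X

closureT : Tree → Tree → Tree → Tree
closureT B R F = tl (saturateT B R (cons R F))

closureᴾ : PolyTime f → PolyTime g → PolyTime h → PolyTime (λ d → closureT (f d) (g d) (h d))
closureᴾ B R F = tlᴾ (saturateᴾ B R (consᴾ R F))

-- An instance is  cons (cons I C) X.

acceptsT : Tree → Tree → Tree
acceptsT G d = andT (anyT hd G) (notT (anyT (λ a → notT (hd a))
  (closureT (backdoorLitsT (tl d)) (rulesT (hd (hd d)) (tl (hd d)) (lettersT (tl (hd d))) G) (factsT (tl d) G))))

acceptsᴾ : PolyTime f → PolyTime g → PolyTime (λ d → acceptsT (f d) (g d))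
acceptsᴾ G D = andᴾ (anyᴾ (hdᴾ v₀) G) (notᴾ (anyᴾ (notᴾ (hdᴾ v₀))
  (closureᴾ (backdoorLitsᴾ (tlᴾ D)) (rulesᴾ (hdᴾ (hdᴾ D)) (tlᴾ (hdᴾ D)) (lettersᴾ (tlᴾ (hdᴾ D))) G)
            (factsᴾ (tlᴾ D) G))))

mergeT : Tree → Tree → Tree
mergeT S T = appendT (mapT (cons trueT) S) (mapT (cons nil) T)

extendGuessesT : Tree → Tree
extendGuessesT Gs = concatMapT (λ S → mapT (mergeT S) Gs) Gs

extendGuessesᴾ : PolyTime extendGuessesT
extendGuessesᴾ = concatMapᴾ (mapᴾ (appendᴾ (mapᴾ (consᴾ trueᴾ v₀) (weaken v₀)) (mapᴾ (consᴾ nilᴾ v₀) v₀))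
                                  (tlᴾ idᴾ)) idᴾ

decideT : Tree → Tree
decideT d = anyT (λ G → acceptsT G (tl d)) (hd d)

decideᴾ : PolyTime decideT
decideᴾ = anyᴾ (acceptsᴾ v₀ (weaken (tlᴾ idᴾ))) (hdᴾ idᴾ)

lengthT : Tree → Tree
lengthT X = mapT (λ _ → nil) X

lengthᴾ : PolyTime f → PolyTime (λ d → lengthT (f d))
lengthᴾ F = mapᴾ nilᴾ F

lengthT-encode : ∀ (e : A → Tree) xs → lengthT (encodeList e xs) ≡ encodeℕ (length xs)
lengthT-encode e []       = refl
lengthT-encode e (x ∷ xs) = cong (cons nil) (lengthT-encode e xs)

-- Agreement of the tree programs with the algorithm

encodeLabels : List Label → Tree
encodeLabels = encodeList encodeVar

encodeRules : List Rule → Tree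
encodeRules = encodeList encodeRule

encodeGuesses : List (List Label) → Tree
encodeGuesses = encodeList encodeLabels

module _ (φ : Formula) (X : List Var) where

  open Algorithm φ X

  private
    I C L XT : Tree
    I  = encodeList encodeVar (initial φ)
    C  = encodeList encodeClause (clauses φ)
    L  = encodeList encodeVar (letters φ)
    XT = encodeList encodeVar X

  clauseRuleT-encode : ∀ ℓ c → clauseRuleT (encodeVar ℓ) (encodeClause c) ≡ encodeRule (clauseRule ℓ c)
  clauseRuleT-encode ℓ c = cong₂ cons (mapT-encode (groundT-encode ℓ) (neg c)) (mapT-encode (groundT-encode ℓ) (pos c))

  origin-encode : ∀ ℓ → hd (encodeVar ℓ) ≡ encodeBool (origin ℓ)
  origin-encode []      = refl
  origin-encode (b ∷ ℓ) = refl

  values-encode : ∀ ℓ → tl (encodeVar ℓ) ≡ encodeVar (values ℓ)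
  values-encode []      = refl
  values-encode (b ∷ ℓ) = refl

  rulesAtT-encode : ∀ ℓ → rulesAtT I C L (encodeVar ℓ) ≡ encodeRules (rulesAt ℓ)
  rulesAtT-encode ℓ = trans
    (cong₂ appendT
      (trans (cong₂ (λ b rs → ifT b rs nil) (origin-encode ℓ)
                    (mapT-encode {f = initialRule ℓ} (λ p → refl) (initial φ)))
             (ifT-encode encodeRules (origin ℓ)))
      (trans (cong₂ appendT (mapT-encode (clauseRuleT-encode ℓ) (clauses φ))
                            (mapT-encode {f = □-elim ℓ} (λ p → refl) (letters φ)))
             (appendT-encode encodeRule (map (clauseRule ℓ) (clauses φ)) (map (□-elim ℓ) (letters φ)))))
    (appendT-encode encodeRule (ifᵇ origin ℓ then map (initialRule ℓ) (initial φ) else []) _)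

  rulesT-encode : ∀ G → rulesT I C L (encodeLabels G) ≡ encodeRules (rules G)
  rulesT-encode G = trans
    (cong₂ appendT (concatMapT-encode {s = rulesAtT I C L} rulesAtT-encode G)
      (mapT-encode {f = □-intro G} (λ p → cong (λ as → cons as (singletonT (cons (□*T (encodeVar p)) nil)))
        (mapT-encode {e′ = encodeAtom} {f = λ ℓ → var p , ℓ} (λ ℓ → refl) G)) (letters φ)))
    (appendT-encode encodeRule (concatMap rulesAt G) (map (□-intro G) (letters φ)))

  nowFactsT-encode : ∀ G → nowFactsT XT (encodeLabels G) ≡ encodeAtoms (nowFacts G)
  nowFactsT-encode = concatMapT-encode {s = nowFactsAtT XT} λ ℓ → trans
    (cong (mapT (λ x → cons (varT x) (encodeVar ℓ)))
          (trans (cong (truthsT XT) (values-encode ℓ)) (truthsT-encode X (values ℓ))))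
    (mapT-encode {e′ = encodeAtom} {f = λ x → var x , ℓ} (λ x → refl) (truths X (values ℓ) []))

  alwaysFactT-encode : ∀ G x → alwaysFactT (encodeAtoms (nowFacts G)) (encodeLabels G) (encodeVar x)
                               ≡ encodeAtoms (alwaysFact G x)
  alwaysFactT-encode G x = trans
    (cong (λ c → ifT c _ nil) (allT-encode (λ ℓ → (var x , ℓ) ∈ᵃ? nowFacts G)
                                           (λ ℓ → memberT-encode (nowFacts G) (var x , ℓ)) G))
    (ifT-encode encodeAtoms (does (all? (λ ℓ → (var x , ℓ) ∈ᵃ? nowFacts G) G)))

  factsT-encode : ∀ G → factsT XT (encodeLabels G) ≡ encodeAtoms (facts G)
  factsT-encode G = trans
    (cong₂ (λ N as → appendT N as) (nowFactsT-encode G)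
      (trans (cong (λ N → concatMapT (alwaysFactT N (encodeLabels G)) XT) (nowFactsT-encode G))
             (concatMapT-encode {s = alwaysFactT (encodeAtoms (nowFacts G)) (encodeLabels G)}
                                (alwaysFactT-encode G) X)))
    (appendT-encode encodeAtom (nowFacts G) (concatMap (alwaysFact G) X))

  backdoorLitsT-encode : backdoorLitsT XT ≡ encodeList encodeTLit backdoorLits
  backdoorLitsT-encode = concatMapT-encode (λ x → refl) X

  instanceT : Tree
  instanceT = cons (encodeFormula φ) XT

  closureT-encode : ∀ G →
    closureT (backdoorLitsT XT) (rulesT I C (lettersT C) (encodeLabels G)) (factsT XT (encodeLabels G))
                          ≡ encodeAtoms (closure G)
  closureT-encode G
    rewrite backdoorLitsT-encode | lettersT-encode φ | rulesT-encode G | factsT-encode G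
    = cong tl (saturateT-encode backdoorLits (rules G) (rules G , facts G))

  acceptsT-encode : ∀ G → acceptsT (encodeLabels G) instanceT ≡ encodeBool (does (accepts? G))
  acceptsT-encode G = trans
    (cong₂ andT (anyT-encode (λ ℓ → origin ℓ Bool.≟ true) originᵇ G)
      (trans (cong notT (trans (cong (anyT _) (closureT-encode G)) (anyT-encode isFalsum? falsumᵇ (closure G))))
             (notT-encode (does (any? isFalsum? (closure G))))))
    (andT-encode (does (any? (λ ℓ → origin ℓ Bool.≟ true) G)) _)
    where
    originᵇ : ∀ ℓ → hd (encodeVar ℓ) ≡ encodeBool (does (origin ℓ Bool.≟ true))
    originᵇ []          = refl
    originᵇ (true  ∷ _) = refl
    originᵇ (false ∷ _) = refl
    falsumᵇ : ∀ a → notT (hd (encodeAtom a)) ≡ encodeBool (does (isFalsum? a))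
    falsumᵇ (⊥ , _)     = refl
    falsumᵇ (var _ , _) = refl
    falsumᵇ (□* _ , _)  = refl

  decideT-encode : decideT (cons (encodeGuesses (guesses (suc (length X)))) instanceT)
                   ≡ encodeBool (does (satisfiable? φ X))
  decideT-encode = anyT-encode accepts? acceptsT-encode (guesses (suc (length X)))

extendGuessesT-encode : ∀ Gs → extendGuessesT (encodeGuesses Gs) ≡ encodeGuesses (extendGuesses Gs)
extendGuessesT-encode Gs = concatMapT-encode {e = encodeLabels} {s = λ S → mapT (mergeT S) (encodeGuesses Gs)}
  (λ S → mapT-encode {e = encodeLabels} {s = mergeT (encodeLabels S)} (mergeT-encode S) Gs) Gs
  where
  mergeT-encode : ∀ S T → mergeT (encodeLabels S) (encodeLabels T) ≡ encodeLabels (merge S T)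
  mergeT-encode S T = trans (cong₂ appendT (mapT-encode {f = true ∷_} (λ _ → refl) S)
                                           (mapT-encode {f = false ∷_} (λ _ → refl) T))
                            (appendT-encode encodeVar (map (true ∷_) S) (map (false ∷_) T))

-- Assembling the decision procedure

open Iterate extendGuessesᴾ using (iterateT)

iterateT-guesses : ∀ n → iterateT n (encodeGuesses guesses₀) ≡ encodeGuesses (guesses n)
iterateT-guesses zero    = refl
-- `iterateT` applies the function before recursing, `guesses` after, hence the detour through
-- `iterateT-suc`.
iterateT-guesses (suc n) = trans (iterateT-suc n _)
  (trans (cong extendGuessesT (iterateT-guesses n)) (extendGuessesT-encode (guesses n)))
  where
  iterateT-suc : ∀ n a → iterateT (suc n) a ≡ extendGuessesT (iterateT n a)
  iterateT-suc zero    a = refl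
  iterateT-suc (suc n) a = iterateT-suc n (extendGuessesT a)

opaque
  -- The counter has one unit for the origin bit and one for each backdoor variable.
  scheme : ∃[ f ] Computable f × (∃[ P ] ∃[ e ] ∀ d n → cons nil (lengthT (tl d)) ≡ encodeℕ (suc n) → ∃[ t ]
    ( P on d yields decideT (cons (iterateT (suc n) (encodeGuesses guesses₀)) d) time t
    × t ≤ f n * size d ^ e))
  scheme = fpt-scheme extendGuessesᴾ (consᴾ nilᴾ (lengthᴾ (tlᴾ idᴾ))) (encodeGuesses guesses₀) decideᴾ

module _ (x : EvalInstance HORN) where

  open EvalInstance x
  open ParameterisedProblem (Eval□* HORN) using (encode)

  decides : decideT (cons (iterateT (suc (length X)) (encodeGuesses guesses₀)) (encode x))
            ≡ encodeBool (does (satisfiable? φ X))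
  decides = trans (cong (λ Gs → decideT (cons Gs (encode x))) (iterateT-guesses (suc (length X))))
                  (decideT-encode φ X)

  decides-satisfiable : does (satisfiable? φ X) ≡ true ⇔ Satisfiable φ
  decides-satisfiable = mk⇔
    (λ eq → accepted-satisfiable φ X (does-true (satisfiable? φ X) eq))
    (λ sat → dec-true (satisfiable? φ X) (satisfiable-accepted φ X X⊆letters backdoor sat))
    where
    -- `χ⇒β` is available for letters only, so a backdoor variable from the initial part has to be
    -- traced into the matrix by `isCNF`.
    X⊆letters : X ⊆ letters φ
    X⊆letters x∈X = matrixVars⊆letters φ ([ isCNF , id ]′ (∈-++⁻ (initial φ) (X⊆vars x∈X)))

theorem9 : FPT (Eval□* HORN)
theorem9 =
  let f , computable , P , e , runs-in = scheme
  in f , computable , P , e , λ x →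
    let X = EvalInstance.X x
        t , (τ , halts , output) , in-time = runs-in _ (length X) (cong (cons nil) (lengthT-encode encodeVar X))
    in does (satisfiable? (EvalInstance.φ x) X) , t , (τ , halts , trans output (decides x)) , in-time
     , decides-satisfiable x
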